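{- Let $f\in\mathcal{F}$, i.e. $f$ is a real-valued function whose domain contains $\mathbb{N}$ such that $f(0)=0$, $f(k+2)-f(k+1)>f(k+1)-f(k)$ for all $k\in\mathbb{N}$, and $(k-2)f(k)\ge k\,(f(k-1)-f(1))$ for all integers $k\ge 3$. Then for all integers $n\geq 1$ and $m$ with $0\le m\le n-1$, the quasi-star graph $QS(n,m)$ maximizes $\Sigma_f$ over $\mathbb{G}(n,m)$. More precisely: (i) if $m\neq 3$ or $f(3)>3(f(2)-f(1))$, then $QS(n,m)$ uniquely maximizes $\Sigma_f$ over $\mathbb{G}(n,m)$; (ii) if $f(3)=3(f(2)-f(1))$, then $K_3\oplus\overline{K}_{n-3}$ also maximizes $\Sigma_f$ over $\mathbb{G}(n,3)$ for every $n\ge 4$.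
   Context: $\mathbb{N}=\{0,1,2,\dots\}$. Graphs are finite and simple, with vertex set $\{1,\dots,n\}$; $\mathbb{G}(n,m)$ is the set of graphs with $n$ vertices and $m$ edges. For a graph with degree sequence $d=(d_1,\dots,d_n)$, $\Sigma_f(d)=\sum_{i=1}^n f(d_i)$. A graph $G\in\mathbb{G}(n,m)$ maximizes $\Sigma_f$ over $\mathbb{G}(n,m)$ if its degree sequence attains the maximum of $\Sigma_f$ among all degree sequences of graphs in $\mathbb{G}(n,m)$; it uniquely maximizes $\Sigma_f$ if moreover, up to isomorphism, it is the only graph in $\mathbb{G}(n,m)$ that does so. $QK(n,m)$ is the graph on $\{1,\dots,n\}$ such that, with $q,r$ the unique integers satisfying $m=\binom q2+r$, $0\le r\le q-1$, the vertices $1,\dots,q$ induce a complete graph, vertex $q+1$ is adjacent exactly to $1,\dots,r$, and vertices $q+2,\dots,n$ are isolated. $QS(n,m)$ is the complement of $QK(n,\binom n2-m)$; when $m\le n-1$ it is isomorphic to $K_{1,m}$ together with $n-m-1$ isolated vertices. $G\oplus H$ is the disjoint union of $G$ and $H$, and $\overline{G}$ is the complement of $G$ (so $\overline{K}_{s}$ consists of $s$ isolated vertices). -}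

module Defs where

open import Algebra.Bundles.Raw using (RawMonoid)
open import Data.Fin as Fin using (Fin; toℕ; splitAt)
open import Data.Fin.Permutation using (Permutation′; _⟨$⟩ʳ_)
open import Data.List using (List; length; filter; allFin; cartesianProduct)
open import Data.Nat as ℕ using (ℕ; zero; suc; _∸_)
import Data.Nat.Properties as ℕ
open import Data.Nat.Combinatorics using (_C_; nC1≡n; nCk+nC[k+1]≡[n+1]C[k+1])
open import Data.Product using (_×_; _,_; proj₁; proj₂; ∃; ∃₂; Σ-syntax)
open import Data.Rational as ℚ using (ℚ; 0ℚ; ½; ∣_∣)
import Data.Rational.Properties as ℚ
open import Data.Rational.Solver using (module +-*-Solver)
open import Data.Sum using (_⊎_)
import Data.Sum as Sum
open import Data.Sum.Relation.Binary.Pointwise as Pointwise using (Pointwise)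
open import Function using (_∘_; _⇔_)
open import Level using (0ℓ)
open import Relation.Binary.Core using (Rel)
open import Relation.Binary.Definitions using (Symmetric; Irreflexive; Decidable)
open import Relation.Binary.PropositionalEquality
  using (_≡_; _≢_; refl; sym; trans; cong; subst; module ≡-Reasoning)
open import Relation.Nullary using (¬_; yes; no)
open import Relation.Nullary.Decidable using (_×-dec_; _⊎-dec_; ¬?)
open import Relation.Unary using (Pred; _∈_)

------------------------------------------------------------------------
-- Real numbers: Cauchy sequences of rationals, compared up to _≈_.

IsCauchy : Pred (ℕ → ℚ) 0ℓ
IsCauchy x = ∀ ε → 0ℚ ℚ.< ε →
  ∃ λ N → ∀ i j → N ℕ.≤ i → N ℕ.≤ j → ∣ x i ℚ.- x j ∣ ℚ.< ε

record ℝ : Set where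
  constructor mkℝ
  field
    seq    : ℕ → ℚ
    cauchy : IsCauchy seq

open ℝ public

private
  halve-pos : ∀ ε → 0ℚ ℚ.< ε → 0ℚ ℚ.< ½ ℚ.* ε
  halve-pos ε 0<ε = subst (ℚ._< ½ ℚ.* ε) (ℚ.*-zeroʳ ½) (ℚ.*-monoʳ-<-pos ½ 0<ε)

  halves : ∀ ε → ½ ℚ.* ε ℚ.+ ½ ℚ.* ε ≡ ε
  halves ε = trans (sym (ℚ.*-distribʳ-+ ε ½ ½)) (ℚ.*-identityˡ ε)

  +-interchange-- : ∀ a b c d →
    (a ℚ.+ b) ℚ.- (c ℚ.+ d) ≡ (a ℚ.- c) ℚ.+ (b ℚ.- d)
  +-interchange-- = solve 4
    (λ a b c d → (a :+ b) :- (c :+ d) := (a :- c) :+ (b :- d)) refl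
    where open +-*-Solver

  neg-- : ∀ a b → (ℚ.- a) ℚ.- (ℚ.- b) ≡ ℚ.- (a ℚ.- b)
  neg-- = solve 2 (λ a b → (:- a) :- (:- b) := :- (a :- b)) refl
    where open +-*-Solver

infix  4 _≈_ _<_ _≤_
infixl 6 _+_ _-_
infix  8 -_

-- Opaque so that type checking never normalises into the arithmetic of ℚ;
-- proofs about these can still unfold them.
opaque
  _≈_ : Rel ℝ 0ℓ
  x ≈ y = ∀ ε → 0ℚ ℚ.< ε →
    ∃ λ N → ∀ i → N ℕ.≤ i → ∣ seq x i ℚ.- seq y i ∣ ℚ.< ε

  _<_ : Rel ℝ 0ℓ
  x < y = ∃ λ ε → 0ℚ ℚ.< ε ×
    (∃ λ N → ∀ i → N ℕ.≤ i → seq x i ℚ.+ ε ℚ.≤ seq y i)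

  -- Equivalent to ¬ (y < x).
  _≤_ : Rel ℝ 0ℓ
  x ≤ y = ∀ ε → 0ℚ ℚ.< ε →
    ∃ λ N → ∀ i → N ℕ.≤ i → seq x i ℚ.≤ seq y i ℚ.+ ε

  0ℝ : ℝ
  0ℝ = mkℝ (λ _ → 0ℚ) (λ ε 0<ε → 0 , λ _ _ _ _ → 0<ε)

  _+_ : ℝ → ℝ → ℝ
  x + y = mkℝ (λ i → seq x i ℚ.+ seq y i) λ ε 0<ε →
    let (N₁ , p) = cauchy x (½ ℚ.* ε) (halve-pos ε 0<ε)
        (N₂ , q) = cauchy y (½ ℚ.* ε) (halve-pos ε 0<ε)
        open ℚ.≤-Reasoning
    in N₁ ℕ.⊔ N₂ , λ i j N≤i N≤j → begin-strict
      ∣ (seq x i ℚ.+ seq y i) ℚ.- (seq x j ℚ.+ seq y j) ∣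
        ≡⟨ cong ∣_∣ (+-interchange-- (seq x i) (seq y i) (seq x j) (seq y j)) ⟩
      ∣ (seq x i ℚ.- seq x j) ℚ.+ (seq y i ℚ.- seq y j) ∣
        ≤⟨ ℚ.∣p+q∣≤∣p∣+∣q∣ (seq x i ℚ.- seq x j) (seq y i ℚ.- seq y j) ⟩
      ∣ seq x i ℚ.- seq x j ∣ ℚ.+ ∣ seq y i ℚ.- seq y j ∣
        <⟨ ℚ.+-mono-<
             (p i j (ℕ.m⊔n≤o⇒m≤o N₁ N₂ N≤i) (ℕ.m⊔n≤o⇒m≤o N₁ N₂ N≤j))
             (q i j (ℕ.m⊔n≤o⇒n≤o N₁ N₂ N≤i) (ℕ.m⊔n≤o⇒n≤o N₁ N₂ N≤j)) ⟩
      ½ ℚ.* ε ℚ.+ ½ ℚ.* ε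
        ≡⟨ halves ε ⟩
      ε ∎

  -_ : ℝ → ℝ
  - x = mkℝ (λ i → ℚ.- seq x i) λ ε 0<ε →
    let (N , p) = cauchy x ε 0<ε
    in N , λ i j N≤i N≤j →
      subst (ℚ._< ε)
        (sym (trans (cong ∣_∣ (neg-- (seq x i) (seq x j)))
                    (ℚ.∣-p∣≡∣p∣ (seq x i ℚ.- seq x j))))
        (p i j N≤i N≤j)

_-_ : ℝ → ℝ → ℝ
x - y = x + (- y)

+-0-rawMonoid : RawMonoid 0ℓ 0ℓ
+-0-rawMonoid = record { Carrier = ℝ ; _≈_ = _≈_ ; _∙_ = _+_ ; ε = 0ℝ }

-- k · x is the real number x multiplied by the natural number k.
open import Algebra.Definitions.RawMonoid +-0-rawMonoid public
  using (sum) renaming (_×_ to infixr 8 _·_)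

------------------------------------------------------------------------
-- The class of functions.  Only the values on ℕ matter, so a real function
-- whose domain contains ℕ is represented by its restriction to ℕ.

record 𝓕 (f : ℕ → ℝ) : Set where
  field
    f0≈0   : f 0 ≈ 0ℝ
    convex : ∀ k → f (k ℕ.+ 1) - f k < f (k ℕ.+ 2) - f (k ℕ.+ 1)
    growth : ∀ k → 3 ℕ.≤ k → k · (f (k ∸ 1) - f 1) ≤ (k ∸ 2) · f k

------------------------------------------------------------------------
-- Graphs

-- Vertex v of {1,…,n} is the element of Fin n with toℕ equal to v - 1.
record Graph (n : ℕ) : Set₁ where
  field
    Adj    : Rel (Fin n) 0ℓ
    adj?   : Decidable Adj
    symm   : Symmetric Adj
    irrefl : Irreflexive _≡_ Adj

open Graph public

degree : ∀ {n} → Graph n → Fin n → ℕ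
degree G i = length (filter (adj? G i) (allFin _))

-- Each edge {i , j} is listed once, as the pair with i < j.
edges : ∀ {n} → Graph n → List (Fin n × Fin n)
edges G = filter (λ (i , j) → (i Fin.<? j) ×-dec adj? G i j)
                 (cartesianProduct (allFin _) (allFin _))

𝔾 : (n m : ℕ) → Pred (Graph n) 0ℓ
𝔾 n m G = length (edges G) ≡ m

infix 4 _≅_

_≅_ : ∀ {n} → Graph n → Graph n → Set
_≅_ {n} G H = Σ[ π ∈ Permutation′ n ]
  (∀ i j → Adj G i j ⇔ Adj H (π ⟨$⟩ʳ i) (π ⟨$⟩ʳ j))

complement : ∀ {n} → Graph n → Graph n
complement G = record
  { Adj    = λ i j → i ≢ j × ¬ Adj G i j
  ; adj?   = λ i j → ¬? (i Fin.≟ j) ×-dec ¬? (adj? G i j)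
  ; symm   = λ (i≢j , i≁j) → i≢j ∘ sym , i≁j ∘ symm G
  ; irrefl = λ i≡j (i≢j , _) → i≢j i≡j
  }

K : ∀ n → Graph n
K n = record
  { Adj    = _≢_
  ; adj?   = λ i j → ¬? (i Fin.≟ j)
  ; symm   = _∘ sym
  ; irrefl = λ i≡j i≢j → i≢j i≡j
  }

infixr 6 _⊕_

_⊕_ : ∀ {m n} → Graph m → Graph n → Graph (m ℕ.+ n)
_⊕_ {m} G H = record
  { Adj    = λ i j → Pointwise (Adj G) (Adj H) (splitAt m i) (splitAt m j)
  ; adj?   = λ i j → Pointwise.⊎-decidable (adj? G) (adj? H) (splitAt m i) (splitAt m j)
  ; symm   = Pointwise.⊎-symmetric (symm G) (symm H)
  ; irrefl = λ { {i} refl → Pointwise.⊎-irreflexive (irrefl G) (irrefl H)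
                              (Pointwise.⊎-refl refl refl) }
  }

-- The pair (q , r) with m = C(q,2) + r and r ≤ q - 1; it is unique because
-- the intervals [C(q,2) , C(q+1,2)) are disjoint.
decompose : ∀ m → ∃₂ λ q r → m ≡ (q C 2) ℕ.+ r × r ℕ.< q
decompose zero = 1 , 0 , refl , ℕ.≤-refl
decompose (suc m) with decompose m
... | q , r , m≡ , r<q with suc r ℕ.<? q
...   | yes 1+r<q = q , suc r , trans (cong suc m≡) (sym (ℕ.+-suc (q C 2) r)) , 1+r<q
...   | no  1+r≮q = suc q , 0 , eq , ℕ.z<s
  where
  open ≡-Reasoning
  eq : suc m ≡ (suc q C 2) ℕ.+ 0
  eq = begin
    suc m                  ≡⟨ cong suc m≡ ⟩
    suc ((q C 2) ℕ.+ r)    ≡⟨ ℕ.+-suc (q C 2) r ⟨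
    (q C 2) ℕ.+ suc r      ≡⟨ cong ((q C 2) ℕ.+_) (ℕ.≤-antisym r<q (ℕ.≮⇒≥ 1+r≮q)) ⟩
    (q C 2) ℕ.+ q          ≡⟨ ℕ.+-comm (q C 2) q ⟩
    q ℕ.+ (q C 2)          ≡⟨ cong (ℕ._+ (q C 2)) (nC1≡n q) ⟨
    (q C 1) ℕ.+ (q C 2)    ≡⟨ nCk+nC[k+1]≡[n+1]C[k+1] q 1 ⟩
    suc q C 2              ≡⟨ ℕ.+-identityʳ (suc q C 2) ⟨
    (suc q C 2) ℕ.+ 0      ∎

-- Vertices are counted from 0 here: the clique is {0,…,q-1}, and the vertex
-- with index q is joined exactly to {0,…,r-1}.
QK : ∀ n (m : ℕ) → Graph n
QK n m = record
  { Adj    = λ i j → i ≢ j × (Clique i j ⊎ Spoke i j ⊎ Spoke j i)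
  ; adj?   = λ i j → ¬? (i Fin.≟ j) ×-dec
                     (clique? i j ⊎-dec (spoke? i j ⊎-dec spoke? j i))
  ; symm   = λ (i≢j , a) → i≢j ∘ sym , Sum.map (λ (p , q) → q , p) Sum.swap a
  ; irrefl = λ i≡j (i≢j , _) → i≢j i≡j
  }
  where
  q = proj₁ (decompose m)
  r = proj₁ (proj₂ (decompose m))

  Clique Spoke : Rel (Fin n) 0ℓ
  Clique i j = toℕ i ℕ.< q × toℕ j ℕ.< q
  Spoke  i j = toℕ i ≡ q × toℕ j ℕ.< r

  clique? : Decidable Clique
  clique? i j = (toℕ i ℕ.<? q) ×-dec (toℕ j ℕ.<? q)

  spoke? : Decidable Spoke
  spoke? i j = (toℕ i ℕ.≟ q) ×-dec (toℕ j ℕ.<? r)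

QS : ∀ n (m : ℕ) → Graph n
QS n m = complement (QK n ((n C 2) ∸ m))

------------------------------------------------------------------------
-- Maximization over 𝔾 n m

Σ[_] : (ℕ → ℝ) → ∀ {n} → (Fin n → ℕ) → ℝ
Σ[ f ] d = sum (f ∘ d)

Maximizes : (f : ℕ → ℝ) (n m : ℕ) → Graph n → Set₁
Maximizes f n m G =
  G ∈ 𝔾 n m × (∀ H → H ∈ 𝔾 n m → Σ[ f ] (degree H) ≤ Σ[ f ] (degree G))

UniquelyMaximizes : (f : ℕ → ℝ) (n m : ℕ) → Graph n → Set₁
UniquelyMaximizes f n m G =
  Maximizes f n m G × (∀ H → Maximizes f n m H → H ≅ G)

{-# OPTIONS --safe #-}

-- Put g k = f k - k f(1).  Then g 0 = g 1 = 0, g 2 > 0, and the growth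
-- condition says that g k / (k (k - 1)) is nondecreasing for k ≥ 2, so for a
-- graph with m edges Σ g(dᵢ) ≤ g(m) Σ dᵢ (dᵢ - 1) / (m (m - 1)).  Since
-- Σ dᵢ = 2m is fixed, it remains to see that Σ dᵢ (dᵢ - 1) ≤ m (m - 1), strictly
-- unless m = 3 or some vertex lies on all m edges; this follows from Σ dᵢ = 2m
-- and dᵢ + dⱼ ≤ m + 1 for i ≠ j.  For m = 3 and all dᵢ ≤ 2 the same comparison
-- with 2 in place of m gives Σ g(dᵢ) ≤ 3 g(2).
module Submission where

-- Since the degrees sum to 2m, passing from f to g changes `Σ[ f ]` by the same amount 2m f(1) on
-- all of `𝔾 n m`. The order of these reals cannot be decided and no quotient of reals is formed:
-- ratios are cross-multiplied into natural multiples, and no case distinction compares two reals.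
-- Uniqueness therefore asks whether some vertex has degree m, which is decidable. If one has, the
-- graph is a star, and stars with equally many edges are isomorphic; if none has, a strict
-- inequality between integer coefficients contradicts g(m) > 0, except for the small values of m
-- and for m = 3. The quadratic bound has two regimes. If some degree D satisfies 2D ≥ m + 2, the
-- pair condition keeps all others at most m + 1 - D. Otherwise every dᵢ - 1 is at most (m - 1)/2,
-- and summing against Σ dᵢ = 2m suffices. Equality in the second regime is what singles out m = 3:
-- the triangle has all its nonzero degrees equal to (m + 1)/2 = 2.

module Combinatorics where

  open import Data.Bool.Base using (if_then_else_)
  open import Data.Fin as Fin using (Fin; zero; suc; punchIn; toℕ; fromℕ)
  open import Data.Fin.Patterns using (0F; 1F; 2F)
  open import Data.Fin.Permutation
    using (Permutation; Permutation′; _⟨$⟩ʳ_; _⟨$⟩ˡ_; insert; id; inverseˡ)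
  import Data.Fin.Properties as Fin
  open import Data.List.Base
    using ([]; _∷_; _++_; length; filter; map; tabulate; allFin; cartesianProduct)
  import Data.List.Properties as List
  open import Data.Nat
  open import Data.Nat.Combinatorics using (_C_; nC1≡n; nCk+nC[k+1]≡[n+1]C[k+1])
  open import Data.Nat.Divisibility
  open import Data.Nat.Properties
  open import Data.Nat.Tactic.RingSolver using (solve-∀)
  open import Data.Product using (_×_; _,_; proj₁; proj₂; ∃)
  open import Data.Sum as Sum using (_⊎_; inj₁; inj₂; [_,_]′)
  open import Function using (_∘_; _⇔_; mk⇔; Equivalence)
  open import Relation.Binary.Definitions using (tri<; tri≈; tri>)
  open import Relation.Binary.PropositionalEquality
  open import Relation.Nullary using (¬_; Dec; yes; no; does; contradiction)
  open import Relation.Nullary.Decidable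
    using (_×-dec_; ¬?; does-⇔; dec-true; dec-false; decidable-stable; toWitnessFalse)
  import Relation.Unary as Unary
  open import Algebra.Properties.CommutativeMonoid.Sum +-0-commutativeMonoid
    using (sum; sum-remove; sum-cong-≗; ∑-distrib-+; ∑-comm; sum-replicate-zero)
  open import Algebra.Properties.Semiring.Sum +-*-semiring using (*-distribˡ-sum; *-distribʳ-sum)
  open import Defs hiding (_≈_; _<_; _≤_; _+_; _-_; -_; 0ℝ; sum; _·_)

  private variable
    m n : ℕ
    P Q : Set

  -- Indicators and finite sums of natural numbers.

  m+m≤n+n⇒m≤n : ∀ {m n} → m + m ≤ n + n → m ≤ n
  m+m≤n+n⇒m≤n {m} {n} 2m≤2n = ≮⇒≥ λ n<m → <⇒≱ (+-mono-< n<m n<m) 2m≤2n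

  𝟙 : Dec P → ℕ
  𝟙 P? = if does P? then 1 else 0

  𝟙-true : (P? : Dec P) → P → 𝟙 P? ≡ 1
  𝟙-true P? p = cong (if_then 1 else 0) (dec-true P? p)

  𝟙-false : (P? : Dec P) → ¬ P → 𝟙 P? ≡ 0
  𝟙-false P? ¬p = cong (if_then 1 else 0) (dec-false P? ¬p)

  𝟙≢0⇒true : (P? : Dec P) → 𝟙 P? ≢ 0 → P
  𝟙≢0⇒true (yes p) _   = p
  𝟙≢0⇒true (no _)  0≢0 = contradiction refl 0≢0

  𝟙≤1 : (P? : Dec P) → 𝟙 P? ≤ 1
  𝟙≤1 (yes _) = ≤-refl
  𝟙≤1 (no _)  = z≤n

  𝟙-⇔ : (P? : Dec P) (Q? : Dec Q) → P ⇔ Q → 𝟙 P? ≡ 𝟙 Q?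
  𝟙-⇔ P? Q? P⇔Q = cong (if_then 1 else 0) (does-⇔ P⇔Q P? Q?)

  sum-mono-≤ : {s t : Fin n → ℕ} → (∀ i → s i ≤ t i) → sum s ≤ sum t
  sum-mono-≤ {zero}  s≤t = ≤-refl
  sum-mono-≤ {suc n} s≤t = +-mono-≤ (s≤t zero) (sum-mono-≤ (s≤t ∘ suc))

  -- Equal totals leave no slack in any term. Every equality case below is analysed through this.
  sum-injective-≤ : {s t : Fin n → ℕ} → (∀ i → s i ≤ t i) → sum t ≤ sum s → s ≗ t
  sum-injective-≤ {s = s} {t} s≤t ∑t≤∑s zero = ≤-antisym (s≤t zero)
    (+-cancelʳ-≤ (sum (s ∘ suc)) _ _
      (≤-trans (+-monoʳ-≤ (t zero) (sum-mono-≤ (s≤t ∘ suc))) ∑t≤∑s))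
  sum-injective-≤ {s = s} {t} s≤t ∑t≤∑s (suc i) = sum-injective-≤ (s≤t ∘ suc)
    (+-cancelˡ-≤ (s zero) _ _ (≤-trans (+-monoˡ-≤ _ (s≤t zero)) ∑t≤∑s)) i

  -- A Kronecker delta: contributions of a distinguished vertex become full sums, so that the later
  -- estimates can be checked vertex by vertex.
  sum-𝟙-≡ : ∀ (i : Fin n) (t : Fin n → ℕ) → sum (λ k → 𝟙 (k Fin.≟ i) * t k) ≡ t i
  sum-𝟙-≡ {suc n} zero t =
    trans (cong₂ _+_ (+-identityʳ (t zero)) (sum-replicate-zero n)) (+-identityʳ (t zero))
  sum-𝟙-≡ (suc i) t = sum-𝟙-≡ i (t ∘ suc)

  term≤sum : ∀ (t : Fin n → ℕ) i → t i ≤ sum t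
  term≤sum t zero    = m≤m+n (t zero) _
  term≤sum t (suc i) = ≤-trans (term≤sum (t ∘ suc) i) (m≤n+m _ (t zero))

  two-terms≤sum : ∀ (t : Fin n → ℕ) {i j} → i ≢ j → t i + t j ≤ sum t
  two-terms≤sum t {zero}  {zero}  i≢j = contradiction refl i≢j
  two-terms≤sum t {zero}  {suc j} i≢j = +-monoʳ-≤ (t zero) (term≤sum (t ∘ suc) j)
  two-terms≤sum t {suc i} {zero}  i≢j =
    subst (_≤ sum t) (+-comm (t zero) (t (suc i))) (+-monoʳ-≤ (t zero) (term≤sum (t ∘ suc) i))
  two-terms≤sum t {suc i} {suc j} i≢j =
    ≤-trans (two-terms≤sum (t ∘ suc) (i≢j ∘ cong suc)) (m≤n+m _ (t zero))

  ∣-sum : ∀ {k} {t : Fin n → ℕ} → (∀ i → k ∣ t i) → k ∣ sum t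
  ∣-sum {zero}  {k} k∣t = k ∣0
  ∣-sum {suc n} k∣t = ∣m∣n⇒∣m+n (k∣t zero) (∣-sum (k∣t ∘ suc))

  length-filter-tabulate : ∀ {A : Set} {P : A → Set} (P? : Unary.Decidable P) (h : Fin n → A) →
                           length (filter P? (tabulate h)) ≡ sum (λ i → 𝟙 (P? (h i)))
  length-filter-tabulate {zero}  P? h = refl
  length-filter-tabulate {suc n} P? h with P? (h zero)
  ... | yes _ = cong suc (length-filter-tabulate P? (h ∘ suc))
  ... | no  _ = length-filter-tabulate P? (h ∘ suc)

  length-filter-map : ∀ {A B : Set} {P : B → Set} (P? : Unary.Decidable P) (h : A → B) xs →
                      length (filter P? (map h xs)) ≡ length (filter (P? ∘ h) xs)
  length-filter-map P? h []       = refl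
  length-filter-map P? h (x ∷ xs) with P? (h x)
  ... | yes _ = cong suc (length-filter-map P? h xs)
  ... | no  _ = length-filter-map P? h xs

  length-filter-cartesianProduct :
    ∀ {A B : Set} {P : A × B → Set} (P? : Unary.Decidable P) (h : Fin n → A) ys →
    length (filter P? (cartesianProduct (tabulate h) ys)) ≡
    sum (λ i → length (filter (λ y → P? (h i , y)) ys))
  length-filter-cartesianProduct {zero}  P? h ys = refl
  length-filter-cartesianProduct {suc n} P? h ys = begin
    length (filter P? (map (h zero ,_) ys ++ rest))
      ≡⟨ cong length (List.filter-++ P? (map (h zero ,_) ys) rest) ⟩
    length (filter P? (map (h zero ,_) ys) ++ filter P? rest)
      ≡⟨ List.length-++ (filter P? (map (h zero ,_) ys)) ⟩
    length (filter P? (map (h zero ,_) ys)) + length (filter P? rest)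
      ≡⟨ cong₂ _+_ (length-filter-map P? (h zero ,_) ys)
                   (length-filter-cartesianProduct P? (h ∘ suc) ys) ⟩
    sum (λ i → length (filter (λ y → P? (h i , y)) ys)) ∎
    where
    open ≡-Reasoning
    rest = cartesianProduct (tabulate (h ∘ suc)) ys

  -- Degrees, edge counts and stars.

  module _ (G : Graph n) where

    adj : Fin n → Fin n → ℕ
    adj i j = 𝟙 (adj? G i j)

    private
      ∣E∣ : ℕ
      ∣E∣ = length (edges G)

      directed? : ∀ i j → Dec (i Fin.< j × Adj G i j)
      directed? i j = (i Fin.<? j) ×-dec adj? G i j

    adj-sym : ∀ i j → adj i j ≡ adj j i
    adj-sym i j = 𝟙-⇔ (adj? G i j) (adj? G j i) (mk⇔ (symm G) (symm G))

    adj-diag : ∀ i → adj i i ≡ 0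
    adj-diag i = 𝟙-false (adj? G i i) (irrefl G refl)

    degree≡sum : ∀ i → degree G i ≡ sum (adj i)
    degree≡sum i = length-filter-tabulate (adj? G i) (λ j → j)

    sum-adj : ∀ i → sum (λ k → adj k i) ≡ degree G i
    sum-adj i = trans (sum-cong-≗ λ k → adj-sym k i) (sym (degree≡sum i))

    adj≡directed : ∀ i j → adj i j ≡ 𝟙 (directed? i j) + 𝟙 (directed? j i)
    adj≡directed i j with Fin.<-cmp i j
    ... | tri< i<j _ j≮i = trans
      (𝟙-⇔ (adj? G i j) (directed? i j) (mk⇔ (i<j ,_) proj₂))
      (sym (trans (cong (𝟙 (directed? i j) +_) (𝟙-false (directed? j i) (j≮i ∘ proj₁))) (+-identityʳ _)))
    ... | tri≈ i≮j refl _ = trans (adj-diag i)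
      (sym (cong₂ _+_ (𝟙-false (directed? i i) (i≮j ∘ proj₁)) (𝟙-false (directed? i i) (i≮j ∘ proj₁))))
    ... | tri> i≮j _ j<i = trans
      (𝟙-⇔ (adj? G i j) (directed? j i) (mk⇔ (λ a → j<i , symm G a) (symm G ∘ proj₂)))
      (sym (cong (_+ 𝟙 (directed? j i)) (𝟙-false (directed? i j) (i≮j ∘ proj₁))))

    ∣E∣≡sum : ∣E∣ ≡ sum (λ i → sum (λ j → 𝟙 (directed? i j)))
    ∣E∣≡sum = trans
      (length-filter-cartesianProduct (λ (i , j) → directed? i j) (λ i → i) (allFin n))
      (sum-cong-≗ λ i → length-filter-tabulate (directed? i) (λ j → j))

    -- `edges` keeps only the orientation i < j. Each adjacency entry splits into its two
    -- orientations, and exchanging the sums makes the second half a copy of the first.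
    handshake : sum (degree G) ≡ ∣E∣ + ∣E∣
    handshake = begin
      sum (degree G)
        ≡⟨ sum-cong-≗ (λ i → trans (degree≡sum i) (trans (sum-cong-≗ (adj≡directed i))
             (∑-distrib-+ (λ j → 𝟙 (directed? i j)) (λ j → 𝟙 (directed? j i))))) ⟩
      sum (λ i → sum (λ j → 𝟙 (directed? i j)) + sum (λ j → 𝟙 (directed? j i)))
        ≡⟨ ∑-distrib-+ (λ i → sum (λ j → 𝟙 (directed? i j))) (λ i → sum (λ j → 𝟙 (directed? j i))) ⟩
      sum (λ i → sum (λ j → 𝟙 (directed? i j))) + sum (λ i → sum (λ j → 𝟙 (directed? j i)))
        ≡⟨ cong₂ _+_ (sym ∣E∣≡sum) (trans (∑-comm (λ i j → 𝟙 (directed? j i))) (sym ∣E∣≡sum)) ⟩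
      ∣E∣ + ∣E∣ ∎
      where open ≡-Reasoning

    adj≤degree : ∀ i j → adj i j ≤ degree G i
    adj≤degree i j = subst (adj i j ≤_) (sym (degree≡sum i)) (term≤sum (adj i) j)

    -- Summed over k this counts every edge at v twice, hence 2 d(v) ≤ 2 ∣E∣.
    degree-split : ∀ v k → 𝟙 (k Fin.≟ v) * degree G k + adj k v ≤ degree G k
    degree-split v k with k Fin.≟ v
    ... | yes refl = ≤-reflexive (trans (cong₂ _+_ (+-identityʳ _) (adj-diag k)) (+-identityʳ _))
    ... | no  _    = adj≤degree k v

    sum-degree-split : ∀ v → sum (λ k → 𝟙 (k Fin.≟ v) * degree G k + adj k v) ≡ degree G v + degree G v
    sum-degree-split v = trans (∑-distrib-+ (λ k → 𝟙 (k Fin.≟ v) * degree G k) (λ k → adj k v))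
      (cong₂ _+_ (sum-𝟙-≡ v (degree G)) (sum-adj v))

    degree≤∣E∣ : ∀ v → degree G v ≤ ∣E∣
    degree≤∣E∣ v = m+m≤n+n⇒m≤n
      (subst₂ _≤_ (sum-degree-split v) handshake (sum-mono-≤ (degree-split v)))

    -- The edges at `i` and those at `j` share at most one edge. In the doubled count, `i` and `j`
    -- each exceed their own degree by at most 1, for the possible edge between them; any other
    -- vertex counts `i` and `j` as two distinct neighbours.
    degree+degree≤1+∣E∣ : ∀ {i j} → i ≢ j → degree G i + degree G j ≤ suc ∣E∣
    degree+degree≤1+∣E∣ {i} {j} i≢j = m+m≤n+n⇒m≤n (begin
      (d i + d j) + (d i + d j)
        ≡⟨ cong₂ _+_ (cong₂ _+_ (sym (sum-𝟙-≡ i d)) (sym (sum-𝟙-≡ j d)))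
                     (cong₂ _+_ (sym (sum-adj i)) (sym (sum-adj j))) ⟩
      (sum (λ k → δ k i * d k) + sum (λ k → δ k j * d k)) + (sum (λ k → adj k i) + sum (λ k → adj k j))
        ≡⟨ cong₂ _+_ (sym (∑-distrib-+ (λ k → δ k i * d k) (λ k → δ k j * d k)))
                     (sym (∑-distrib-+ (λ k → adj k i) (λ k → adj k j))) ⟩
      sum (λ k → δ k i * d k + δ k j * d k) + sum (λ k → adj k i + adj k j)
        ≡⟨ ∑-distrib-+ (λ k → δ k i * d k + δ k j * d k) (λ k → adj k i + adj k j) ⟨
      sum (λ k → (δ k i * d k + δ k j * d k) + (adj k i + adj k j))
        ≤⟨ sum-mono-≤ bound ⟩
      sum (λ k → d k + (δ k i * 1 + δ k j * 1))
        ≡⟨ ∑-distrib-+ d (λ k → δ k i * 1 + δ k j * 1) ⟩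
      sum d + sum (λ k → δ k i * 1 + δ k j * 1)
        ≡⟨ cong₂ _+_ handshake (trans (∑-distrib-+ (λ k → δ k i * 1) (λ k → δ k j * 1))
             (cong₂ _+_ (sum-𝟙-≡ i (λ _ → 1)) (sum-𝟙-≡ j (λ _ → 1)))) ⟩
      ∣E∣ + ∣E∣ + 2
        ≡⟨ double-suc ∣E∣ ⟩
      suc ∣E∣ + suc ∣E∣ ∎)
      where
      open ≤-Reasoning
      d = degree G
      δ : Fin n → Fin n → ℕ
      δ k l = 𝟙 (k Fin.≟ l)
      double-suc : ∀ m → m + m + 2 ≡ suc m + suc m
      double-suc = solve-∀
      bound : ∀ k → (δ k i * d k + δ k j * d k) + (adj k i + adj k j) ≤ d k + (δ k i * 1 + δ k j * 1)
      bound k with k Fin.≟ i | k Fin.≟ j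
      ... | yes refl | yes refl = contradiction refl i≢j
      ... | yes refl | no _ rewrite adj-diag k | +-identityʳ (d k) | +-identityʳ (d k) =
        +-monoʳ-≤ (d k) (𝟙≤1 (adj? G k j))
      ... | no _ | yes refl rewrite adj-diag k | +-identityʳ (d k) | +-identityʳ (adj k i) =
        +-monoʳ-≤ (d k) (𝟙≤1 (adj? G k i))
      ... | no _ | no _ = subst₂ _≤_ refl (sym (trans (+-identityʳ (d k)) (degree≡sum k)))
        (two-terms≤sum (adj k) i≢j)

    -- Isolated vertices are allowed, and an edgeless graph is a star about every vertex, so m = 0
    -- needs no separate notion.
    IsStar : Fin n → Set
    IsStar v = ∀ i j → Adj G i j → i ≡ v ⊎ j ≡ v

    -- In a star the inequality `degree-split` reverses, because a vertex other than `v` has no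
    -- neighbour but `v`.
    isStar⇒degree≡∣E∣ : ∀ {v} → IsStar v → degree G v ≡ ∣E∣
    isStar⇒degree≡∣E∣ {v} star = ≤-antisym (degree≤∣E∣ v) (m+m≤n+n⇒m≤n
      (subst₂ _≤_ handshake (sum-degree-split v) (sum-mono-≤ bound)))
      where
      bound : ∀ k → degree G k ≤ 𝟙 (k Fin.≟ v) * degree G k + adj k v
      bound k with k Fin.≟ v
      ... | yes _ = ≤-trans (m≤m+n _ _) (m≤m+n _ _)
      ... | no k≢v = subst₂ _≤_ (sym (degree≡sum k)) (sum-𝟙-≡ v (adj k)) (sum-mono-≤ only-v)
        where
        only-v : ∀ l → adj k l ≤ 𝟙 (l Fin.≟ v) * adj k l
        only-v l with l Fin.≟ v
        ... | yes _  = m≤m+n _ _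
        ... | no l≢v = ≤-reflexive (𝟙-false (adj? G k l) ([ k≢v , l≢v ]′ ∘ star k l))

    -- Equality in the doubled count makes `degree-split` tight at every vertex, so a vertex other
    -- than `v` has at most `v` as a neighbour.
    degree≡∣E∣⇒isStar : ∀ {v} → degree G v ≡ ∣E∣ → IsStar v
    degree≡∣E∣⇒isStar {v} dv≡∣E∣ i j i∼j with i Fin.≟ v | j Fin.≟ v
    ... | yes i≡v | _       = inj₁ i≡v
    ... | no _    | yes j≡v = inj₂ j≡v
    ... | no i≢v  | no j≢v  = contradiction (≤-reflexive di≡) (<⇒≱ (begin-strict
        adj i v            <⟨ n<1+n (adj i v) ⟩
        1 + adj i v        ≡⟨ cong (_+ adj i v) (𝟙-true (adj? G i j) i∼j) ⟨
        adj i j + adj i v  ≤⟨ two-terms≤sum (adj i) j≢v ⟩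
        sum (adj i)        ≡⟨ degree≡sum i ⟨
        degree G i         ∎))
      where
      open ≤-Reasoning
      tight : 𝟙 (i Fin.≟ v) * degree G i + adj i v ≡ degree G i
      tight = sum-injective-≤ (degree-split v)
        (≤-reflexive (trans handshake
          (sym (trans (sum-degree-split v) (cong₂ _+_ dv≡∣E∣ dv≡∣E∣))))) i
      di≡ : degree G i ≡ adj i v
      di≡ = trans (sym tight) (cong (λ x → x * degree G i + adj i v) (𝟙-false (i Fin.≟ v) i≢v))

  -- The quadratic bound on degree sequences.

  module _ {m} (d : Fin n → ℕ) (sum-d : sum d ≡ m + m)
           (d≤m : ∀ i → d i ≤ m) (d+d≤1+m : ∀ {i j} → i ≢ j → d i + d j ≤ suc m) where

    private
      ∑d[d-1] : ℕ
      ∑d[d-1] = sum (λ i → d i * (d i ∸ 1))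

    -- With D = d v, the other degrees are at most e + 1 where e = m - D; the
    -- slack is e (D - e - 1), written without subtraction.
    large-degree : ∀ v e t → d v ≡ 2 + (e + t) → m ≡ d v + e → ∑d[d-1] + e * suc t ≤ m * (m ∸ 1)
    -- The added `d v * e` completes e times the sum of the other degrees to e times the full sum,
    -- which is 2me.
    large-degree v e t dv≡ m≡ = +-cancelʳ-≤ (d v * e) _ _ (begin
      ∑d[d-1] + e * suc t + d v * e
        ≡⟨ rearrange ∑d[d-1] (e * suc t) (d v * e) ⟩
      ∑d[d-1] + d v * e + e * suc t
        ≡⟨ cong (_+ e * suc t) (trans
             (∑-distrib-+ (λ i → d i * (d i ∸ 1)) (λ i → 𝟙 (i Fin.≟ v) * (d i * e)))
             (cong (∑d[d-1] +_) (sum-𝟙-≡ v (λ i → d i * e)))) ⟨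
      sum (λ i → d i * (d i ∸ 1) + 𝟙 (i Fin.≟ v) * (d i * e)) + e * suc t
        ≤⟨ +-monoˡ-≤ (e * suc t) (sum-mono-≤ bound) ⟩
      sum (λ i → 𝟙 (i Fin.≟ v) * (d i * (d i ∸ 1)) + d i * e) + e * suc t
        ≡⟨ cong (_+ e * suc t) (trans
             (∑-distrib-+ (λ i → 𝟙 (i Fin.≟ v) * (d i * (d i ∸ 1))) (λ i → d i * e))
             (cong₂ _+_ (sum-𝟙-≡ v (λ i → d i * (d i ∸ 1)))
                        (trans (sym (*-distribʳ-sum e d)) (cong (_* e) sum-d)))) ⟩
      d v * (d v ∸ 1) + (m + m) * e + e * suc t
        ≡⟨ cong (λ m → d v * (d v ∸ 1) + (m + m) * e + e * suc t) m≡ ⟩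
      d v * (d v ∸ 1) + (d v + e + (d v + e)) * e + e * suc t
        ≡⟨ cong (λ x → x * (x ∸ 1) + (x + e + (x + e)) * e + e * suc t) dv≡ ⟩
      (2 + (e + t)) * (1 + (e + t)) + (2 + (e + t) + e + (2 + (e + t) + e)) * e + e * suc t
        ≡⟨ identity e t ⟩
      (2 + (e + t) + e) * (1 + (e + t) + e) + (2 + (e + t)) * e
        ≡⟨ cong (λ x → (x + e) * (x + e ∸ 1) + x * e) dv≡ ⟨
      (d v + e) * (d v + e ∸ 1) + d v * e
        ≡⟨ cong (λ m → m * (m ∸ 1) + d v * e) m≡ ⟨
      m * (m ∸ 1) + d v * e ∎)
      where
      open ≤-Reasoning
      rearrange : ∀ a b c → a + b + c ≡ a + c + b
      rearrange = solve-∀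
      identity : ∀ e t →
        (2 + (e + t)) * (1 + (e + t)) + (2 + (e + t) + e + (2 + (e + t) + e)) * e + e * suc t ≡
        (2 + (e + t) + e) * (1 + (e + t) + e) + (2 + (e + t)) * e
      identity = solve-∀
      bound : ∀ i → d i * (d i ∸ 1) + 𝟙 (i Fin.≟ v) * (d i * e) ≤
                    𝟙 (i Fin.≟ v) * (d i * (d i ∸ 1)) + d i * e
      bound i with i Fin.≟ v
      ... | yes _  = ≤-reflexive (cong₂ _+_ (sym (+-identityʳ (d i * (d i ∸ 1)))) (+-identityʳ (d i * e)))
      ... | no i≢v = subst (_≤ d i * e) (sym (+-identityʳ _)) (*-monoʳ-≤ (d i)
        (∸-monoˡ-≤ 1 (+-cancelʳ-≤ (d v) (d i) (suc e) (begin
          d i + d v       ≤⟨ d+d≤1+m i≢v ⟩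
          suc m           ≡⟨ cong suc (trans m≡ (+-comm (d v) e)) ⟩
          suc (e + d v)   ∎))))

    module _ (small : ∀ i → d i + d i ≤ suc m) where

      -- Here d - 1 is at most (m - 1)/2; doubling avoids the half, and the right side is linear in
      -- the degree, so its sum is known.
      small-term : ∀ i → 2 * (d i * (d i ∸ 1)) ≤ (m ∸ 1) * d i
      small-term i = begin
        2 * (d i * (d i ∸ 1))    ≡⟨ assoc (d i) (d i ∸ 1) ⟩
        2 * (d i ∸ 1) * d i      ≤⟨ *-monoˡ-≤ (d i) 2[di-1]≤m-1 ⟩
        (m ∸ 1) * d i            ∎
        where
        open ≤-Reasoning
        assoc : ∀ a b → 2 * (a * b) ≡ 2 * b * a
        assoc = solve-∀
        2[di-1]≤m-1 : 2 * (d i ∸ 1) ≤ m ∸ 1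
        2[di-1]≤m-1 = begin
          2 * (d i ∸ 1)    ≡⟨ *-distribˡ-∸ 2 (d i) 1 ⟩
          2 * d i ∸ 2      ≡⟨ cong (λ x → d i + x ∸ 2) (+-identityʳ (d i)) ⟩
          d i + d i ∸ 2    ≤⟨ ∸-monoˡ-≤ 2 (small i) ⟩
          m ∸ 1            ∎

      sum-small : sum (λ i → (m ∸ 1) * d i) ≡ 2 * (m * (m ∸ 1))
      sum-small = begin
        sum (λ i → (m ∸ 1) * d i)  ≡⟨ *-distribˡ-sum (m ∸ 1) d ⟨
        (m ∸ 1) * sum d            ≡⟨ cong ((m ∸ 1) *_) sum-d ⟩
        (m ∸ 1) * (m + m)          ≡⟨ double m (m ∸ 1) ⟩
        2 * (m * (m ∸ 1))          ∎
        where
        open ≡-Reasoning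
        double : ∀ a b → b * (a + a) ≡ 2 * (a * b)
        double = solve-∀

      small-degrees : ∑d[d-1] ≤ m * (m ∸ 1)
      small-degrees = *-cancelˡ-≤ 2 (subst₂ _≤_
        (sym (*-distribˡ-sum 2 (λ i → d i * (d i ∸ 1)))) sum-small (sum-mono-≤ small-term))

      -- Equality forces every degree to be 0 or (m + 1) / 2, so that m + 1
      -- divides 2 Σ d = 4 m, hence 4.
      small-degrees-strict : 2 ≤ m → m ≢ 3 → ∑d[d-1] < m * (m ∸ 1)
      small-degrees-strict 2≤m m≢3 = ≤∧≢⇒< small-degrees λ eq →
        no-divisor 2≤m m≢3 (1+m∣4 eq)
        where
        -- With m ≥ 2 the divisor m + 1 of 4 is at least 3, hence equal to 4.
        no-divisor : 2 ≤ m → m ≢ 3 → ¬ suc m ∣ 4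
        no-divisor 2≤m m≢3 1+m∣4 with ∣⇒≤ 1+m∣4
        no-divisor (s≤s (s≤s z≤n)) m≢3 3∣4 | s≤s (s≤s (s≤s z≤n)) = toWitnessFalse {a? = 3 ∣? 4} _ 3∣4
        no-divisor (s≤s (s≤s z≤n)) m≢3 1+m∣4 | s≤s (s≤s (s≤s (s≤s z≤n))) = m≢3 refl

        1+m∣2d : ∀ i → 2 * (d i * (d i ∸ 1)) ≡ (m ∸ 1) * d i → suc m ∣ 2 * d i
        1+m∣2d i eq with d i
        ... | zero  = suc m ∣0
        ... | suc x = ∣-reflexive (sym (begin
          2 * suc x           ≡⟨ *-suc 2 x ⟩
          2 + 2 * x           ≡⟨ cong (2 +_) (*-cancelʳ-≡ (2 * x) (m ∸ 1) (suc x) (trans (comm x) eq)) ⟩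
          2 + (m ∸ 1)         ≡⟨ cong suc (m+[n∸m]≡n (<⇒≤ 2≤m)) ⟩
          suc m               ∎))
          where
          open ≡-Reasoning
          comm : ∀ x → 2 * x * suc x ≡ 2 * (suc x * x)
          comm = solve-∀

        1+m∣4 : ∑d[d-1] ≡ m * (m ∸ 1) → suc m ∣ 4
        1+m∣4 eq = ∣m+n∣m⇒∣n
          (subst (suc m ∣_) (identity m) (n∣m*n 4))
          (subst (suc m ∣_) (trans (sym (*-distribˡ-sum 2 d)) (trans (cong (2 *_) sum-d) (four m)))
            (∣-sum λ i → 1+m∣2d i (tight i)))
          where
          identity : ∀ m → 4 * suc m ≡ 4 * m + 4
          identity = solve-∀
          four : ∀ m → 2 * (m + m) ≡ 4 * m
          four = solve-∀
          tight : ∀ i → 2 * (d i * (d i ∸ 1)) ≡ (m ∸ 1) * d i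
          tight = sum-injective-≤ small-term (≤-reflexive (trans sum-small
            (trans (cong (2 *_) (sym eq)) (*-distribˡ-sum 2 (λ i → d i * (d i ∸ 1))))))

    -- The threshold 2 d(v) ≥ m + 2 is exactly the condition for t = d(v) - 2 - (m - d(v)) to be a
    -- natural number, as `large-degree` requires.
    large-or-small :
      (∃ λ v → ∃ λ t → d v ≡ 2 + (m ∸ d v + t)) ⊎ (∀ i → d i + d i ≤ suc m)
    large-or-small with Fin.any? (λ v → suc (suc m) ≤? d v + d v)
    ... | no none = inj₂ λ i → ≤-pred (≰⇒> (none ∘ (i ,_)))
    ... | yes (v , large) = inj₁ (v , d v ∸ (2 + (m ∸ d v)) , sym (m+[n∸m]≡n
      (+-cancelʳ-≤ (d v) _ _ (≤-trans (≤-reflexive (cong (2 +_) (m∸n+n≡m (d≤m v)))) large))))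

    ∑d[d-1]≤m[m-1] : ∑d[d-1] ≤ m * (m ∸ 1)
    ∑d[d-1]≤m[m-1] with large-or-small
    ... | inj₁ (v , t , dv≡) =
      ≤-trans (m≤m+n _ _) (large-degree v (m ∸ d v) t dv≡ (sym (m+[n∸m]≡n (d≤m v))))
    ... | inj₂ small = small-degrees small

    ∑d[d-1]<m[m-1] : 2 ≤ m → m ≢ 3 → (∀ i → d i ≢ m) → ∑d[d-1] < m * (m ∸ 1)
    ∑d[d-1]<m[m-1] 2≤m m≢3 d≢m with large-or-small
    -- The slack (m - d(v))(t + 1) is positive because `d v` differs from m.
    ... | inj₁ (v , t , dv≡) = <-≤-trans
      (m<m+n ∑d[d-1] (*-mono-≤ (m<n⇒0<n∸m (≤∧≢⇒< (d≤m v) (d≢m v))) (s≤s (z≤n {t}))))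
      (large-degree v (m ∸ d v) t dv≡ (sym (m+[n∸m]≡n (d≤m v))))
    ... | inj₂ small = small-degrees-strict small 2≤m m≢3

  -- Isomorphism of stars.

  insert-≗ : ∀ (s : Fin (suc m) → ℕ) (t : Fin (suc n) → ℕ) i j (π : Permutation m n) →
             s i ≡ t j → (∀ k → s (punchIn i k) ≡ t (punchIn j (π ⟨$⟩ʳ k))) →
             ∀ k → s k ≡ t (insert i j π ⟨$⟩ʳ k)
  -- This test is the one by which `insert` is defined, so the permutation reduces in both branches.
  insert-≗ s t i j π si≡tj s≗t k with i Fin.≟ k
  ... | yes refl = si≡tj
  ... | no i≢k   = trans (cong s (sym (Fin.punchIn-punchOut i≢k))) (s≗t (Fin.punchOut i≢k))

  sum≡0⇒≗0 : (t : Fin n → ℕ) → sum t ≡ 0 → ∀ i → t i ≡ 0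
  sum≡0⇒≗0 t ∑t≡0 i = n≤0⇒n≡0 (subst (t i ≤_) ∑t≡0 (term≤sum t i))

  ≗0⇒sum≡0 : {t : Fin n → ℕ} → (∀ i → t i ≡ 0) → sum t ≡ 0
  ≗0⇒sum≡0 {n} t≗0 = trans (sum-cong-≗ t≗0) (sum-replicate-zero n)

  find-nonzero : (t : Fin n → ℕ) → (∃ λ i → t i ≢ 0) ⊎ (∀ i → t i ≡ 0)
  find-nonzero t with Fin.any? (λ i → ¬? (t i ≟ 0))
  ... | yes nonzero = inj₁ nonzero
  ... | no  none    = inj₂ λ i → decidable-stable (t i ≟ 0) λ ti≢0 → none (i , ti≢0)

  -- Pair a one of `s` with a one of `t`, delete both, and recurse. Once `s` has no ones, neither
  -- has `t`, and the identity serves.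
  match-indicators : (s t : Fin n → ℕ) → (∀ i → s i ≤ 1) → (∀ i → t i ≤ 1) → sum s ≡ sum t →
                     ∃ λ (π : Permutation′ n) → ∀ i → s i ≡ t (π ⟨$⟩ʳ i)
  match-indicators {zero}  s t s≤1 t≤1 ∑s≡∑t = id , λ ()
  match-indicators {suc n} s t s≤1 t≤1 ∑s≡∑t with find-nonzero s | find-nonzero t
  ... | inj₂ s≗0 | _ = id , λ i →
    trans (s≗0 i) (sym (sum≡0⇒≗0 t (trans (sym ∑s≡∑t) (≗0⇒sum≡0 s≗0)) i))
  ... | inj₁ (i , si≢0) | inj₂ t≗0 = contradiction (sum≡0⇒≗0 s (trans ∑s≡∑t (≗0⇒sum≡0 t≗0)) i) si≢0
  ... | inj₁ (i , si≢0) | inj₁ (j , tj≢0) =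
    insert i j (proj₁ rest) , insert-≗ s t i j (proj₁ rest) si≡tj (proj₂ rest)
    where
    open ≡-Reasoning
    si≡tj : s i ≡ t j
    si≡tj = trans (≤-antisym (s≤1 i) (n≢0⇒n>0 si≢0)) (sym (≤-antisym (t≤1 j) (n≢0⇒n>0 tj≢0)))
    rest = match-indicators (s ∘ punchIn i) (t ∘ punchIn j) (s≤1 ∘ punchIn i) (t≤1 ∘ punchIn j)
      (+-cancelˡ-≡ (s i) _ _ (begin
        s i + sum (s ∘ punchIn i)  ≡⟨ sum-remove {i = i} s ⟨
        sum s                      ≡⟨ ∑s≡∑t ⟩
        sum t                      ≡⟨ sum-remove {i = j} t ⟩
        t j + sum (t ∘ punchIn j)  ≡⟨ cong (_+ _) si≡tj ⟨
        s i + sum (t ∘ punchIn j)  ∎))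

  𝟙-≡⇒→ : {P Q : Set} (P? : Dec P) (Q? : Dec Q) → 𝟙 P? ≡ 𝟙 Q? → P → Q
  𝟙-≡⇒→ P? Q? eq p = 𝟙≢0⇒true Q? λ q≡0 → 1+n≢0 (trans (sym (𝟙-true P? p)) (trans eq q≡0))

  -- A star is determined by its centre and its set of leaves. The centres are deleted before the
  -- adjacency rows are matched; otherwise a centre, having entry 0 in its own row, could be sent to
  -- an isolated vertex.
  stars-≅ : ∀ (G H : Graph (suc n)) {v c} → IsStar G v → IsStar H c → degree G v ≡ degree H c → G ≅ H
  stars-≅ {n} G H {v} {c} starG starH dv≡dc = π , λ i j → mk⇔ (to i j) (from i j)
    where
    s t : Fin n → ℕ
    s = adj G v ∘ punchIn v
    t = adj H c ∘ punchIn c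

    sum-leaves : ∀ (G : Graph (suc n)) v → degree G v ≡ sum (adj G v ∘ punchIn v)
    sum-leaves G v = trans (degree≡sum G v) (trans (sum-remove {i = v} (adj G v))
      (cong (_+ sum (adj G v ∘ punchIn v)) (adj-diag G v)))

    matching : ∃ λ (π : Permutation′ n) → ∀ i → s i ≡ t (π ⟨$⟩ʳ i)
    matching = match-indicators s t (λ i → 𝟙≤1 (adj? G v (punchIn v i))) (λ i → 𝟙≤1 (adj? H c (punchIn c i)))
      (trans (sym (sum-leaves G v)) (trans dv≡dc (sum-leaves H c)))

    π : Permutation′ (suc n)
    π = insert v c (proj₁ matching)

    πv≡c : π ⟨$⟩ʳ v ≡ c
    πv≡c with v Fin.≟ v
    ... | yes _  = refl
    ... | no v≢v = contradiction refl v≢v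

    adj≡ : ∀ i → adj G v i ≡ adj H c (π ⟨$⟩ʳ i)
    adj≡ = insert-≗ (adj G v) (adj H c) v c (proj₁ matching)
      (trans (adj-diag G v) (sym (adj-diag H c))) (proj₂ matching)

    to-v : ∀ i → Adj G v i → Adj H (π ⟨$⟩ʳ v) (π ⟨$⟩ʳ i)
    to-v i v∼i = subst (λ c → Adj H c (π ⟨$⟩ʳ i)) (sym πv≡c)
      (𝟙-≡⇒→ (adj? G v i) (adj? H c (π ⟨$⟩ʳ i)) (adj≡ i) v∼i)

    from-v : ∀ i → Adj H (π ⟨$⟩ʳ v) (π ⟨$⟩ʳ i) → Adj G v i
    from-v i c∼πi = 𝟙-≡⇒→ (adj? H c (π ⟨$⟩ʳ i)) (adj? G v i) (sym (adj≡ i))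
      (subst (λ c → Adj H c (π ⟨$⟩ʳ i)) πv≡c c∼πi)

    to : ∀ i j → Adj G i j → Adj H (π ⟨$⟩ʳ i) (π ⟨$⟩ʳ j)
    to i j i∼j with starG i j i∼j
    ... | inj₁ refl = to-v j i∼j
    ... | inj₂ refl = symm H (to-v i (symm G i∼j))

    π-injective : ∀ {i j} → π ⟨$⟩ʳ i ≡ π ⟨$⟩ʳ j → i ≡ j
    π-injective eq = trans (sym (inverseˡ π)) (trans (cong (π ⟨$⟩ˡ_) eq) (inverseˡ π))

    from : ∀ i j → Adj H (π ⟨$⟩ʳ i) (π ⟨$⟩ʳ j) → Adj G i j
    from i j πi∼πj with Sum.map (λ eq → π-injective (trans eq (sym πv≡c)))
                                (λ eq → π-injective (trans eq (sym πv≡c))) (starH _ _ πi∼πj)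
    ... | inj₁ refl = from-v j πi∼πj
    ... | inj₂ refl = symm G (from-v i (symm H πi∼πj))

  -- Quasi-stars with at most n - 1 edges are stars.

  [1+n]C2≡n+nC2 : ∀ n → suc n C 2 ≡ n + n C 2
  [1+n]C2≡n+nC2 n = trans (sym (nCk+nC[k+1]≡[n+1]C[k+1] n 1)) (cong (_+ n C 2) (nC1≡n n))

  C2-mono-≤ : m ≤ n → m C 2 ≤ n C 2
  C2-mono-≤ {n = zero}  z≤n = ≤-refl
  C2-mono-≤ {n = suc n} m≤1+n with m≤n⇒m<n∨m≡n m≤1+n
  ... | inj₁ (s≤s m≤n) =
    ≤-trans (C2-mono-≤ m≤n) (subst (n C 2 ≤_) (sym ([1+n]C2≡n+nC2 n)) (m≤n+m (n C 2) n))
  ... | inj₂ refl = ≤-refl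

  C2+-<-C2+ : ∀ {q q′ r r′} → r < q → q < q′ → q C 2 + r < q′ C 2 + r′
  C2+-<-C2+ {q} {q′} {r} {r′} r<q q<q′ = begin-strict
    q C 2 + r    <⟨ +-monoʳ-< (q C 2) r<q ⟩
    q C 2 + q    ≡⟨ +-comm (q C 2) q ⟩
    q + q C 2    ≡⟨ [1+n]C2≡n+nC2 q ⟨
    suc q C 2    ≤⟨ C2-mono-≤ q<q′ ⟩
    q′ C 2       ≤⟨ m≤m+n (q′ C 2) r′ ⟩
    q′ C 2 + r′  ∎
    where open ≤-Reasoning

  decomposition-unique : ∀ {q q′ r r′} → r < q → r′ < q′ → q C 2 + r ≡ q′ C 2 + r′ → q ≡ q′ × r ≡ r′
  decomposition-unique {q} {q′} r<q r′<q′ eq with <-cmp q q′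
  ... | tri< q<q′ _ _ = contradiction eq (<⇒≢ (C2+-<-C2+ r<q q<q′))
  ... | tri≈ _ refl _ = refl , +-cancelˡ-≡ (q C 2) _ _ eq
  ... | tri> _ _ q′<q = contradiction (sym eq) (<⇒≢ (C2+-<-C2+ r′<q′ q′<q))

  -- `decompose` does not reduce at a symbolic edge count; uniqueness of the pair lets any known q
  -- and r replace its output. An equality of types can be transported in both directions.
  QK-Adj : ∀ {k q r} → k ≡ q C 2 + r → r < q → (i j : Fin n) →
           Adj (QK n k) i j ≡
           (i ≢ j × (toℕ i < q × toℕ j < q ⊎ toℕ i ≡ q × toℕ j < r ⊎ toℕ j ≡ q × toℕ i < r))
  QK-Adj {k = k} {q} {r} k≡ r<q i j = cong₂
    (λ q r → i ≢ j × (toℕ i < q × toℕ j < q ⊎ toℕ i ≡ q × toℕ j < r ⊎ toℕ j ≡ q × toℕ i < r))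
    (proj₁ unique) (proj₂ unique)
    where
    unique : proj₁ (decompose k) ≡ q × proj₁ (proj₂ (decompose k)) ≡ r
    unique with q′ , r′ , k≡′ , r′<q′ ← decompose k =
      decomposition-unique r′<q′ r<q (trans (sym k≡′) k≡)

  sum-upper : ∀ n r → sum {n} (λ j → 𝟙 (r ≤? toℕ j)) ≡ n ∸ r
  sum-upper zero    r       = sym (0∸n≡0 r)
  sum-upper (suc n) zero    = cong suc (sum-upper n zero)
  sum-upper (suc n) (suc r) = trans
    (sum-cong-≗ λ (j : Fin n) → 𝟙-⇔ (suc r ≤? suc (toℕ j)) (r ≤? toℕ j) (mk⇔ ≤-pred s≤s)) (sum-upper n r)

  module _ {n m : ℕ} (m≤n : m ≤ n) where

    private
      centre : Fin (suc n)
      centre = fromℕ n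

      toℕ<n : ∀ {j : Fin (suc n)} → j ≢ centre → toℕ j < n
      toℕ<n {j} j≢c = ≤∧≢⇒< (≤-pred (Fin.toℕ<n j))
        λ eq → j≢c (Fin.toℕ-injective (trans eq (sym (Fin.toℕ-fromℕ n))))

    -- For m ≥ 1, C(n+1,2) - m = C(n,2) + (n - m): the clique of QK is {0,…,n-1}
    -- and vertex n is the centre of the star.  For m = 0 the clique is everything.
    QS-star : IsStar (QS (suc n) m) centre ×
              (∀ j → Adj (QS (suc n) m) centre j ⇔ (centre ≢ j × n ∸ m ≤ toℕ j))
    QS-star with m ≟ 0
    ... | yes refl =
      (λ i j (i≢j , ≁) → contradiction (clique i≢j) ≁) ,
      -- For m = 0 both sides are empty: only the centre has index at least n.
      (λ j → mk⇔ (λ (c≢j , ≁) → contradiction (clique c≢j) ≁)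
                 (λ (c≢j , n≤j) → contradiction n≤j (<⇒≱ (toℕ<n (c≢j ∘ sym)))))
      where
      clique : ∀ {i j} → i ≢ j → Adj (QK (suc n) (suc n C 2)) i j
      clique {i} {j} i≢j = subst (λ A → A) (sym (QK-Adj (sym (+-identityʳ _)) z<s i j))
        (i≢j , inj₁ (Fin.toℕ<n i , Fin.toℕ<n j))
    ... | no m≢0 = star , leaves
      where
      k≡ : (suc n C 2) ∸ m ≡ n C 2 + (n ∸ m)
      k≡ = trans (cong (_∸ m) ([1+n]C2≡n+nC2 n)) (trans (cong (_∸ m) (+-comm n (n C 2))) (+-∸-assoc (n C 2) m≤n))

      -- This is where m ≥ 1 matters: the remainder n would be too large for a clique on n vertices.
      r<n : n ∸ m < n
      r<n = ∸-monoʳ-< (n≢0⇒n>0 m≢0) m≤n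

      QK≡ = QK-Adj k≡ r<n

      star : IsStar (QS (suc n) m) centre
      star i j (i≢j , ≁) with i Fin.≟ centre | j Fin.≟ centre
      ... | yes i≡c | _       = inj₁ i≡c
      ... | no _    | yes j≡c = inj₂ j≡c
      ... | no i≢c  | no j≢c  = contradiction
        (subst (λ A → A) (sym (QK≡ i j)) (i≢j , inj₁ (toℕ<n i≢c , toℕ<n j≢c))) ≁

      leaves : ∀ j → Adj (QS (suc n) m) centre j ⇔ (centre ≢ j × n ∸ m ≤ toℕ j)
      leaves j = mk⇔
        (λ (c≢j , ≁) → c≢j , ≮⇒≥ λ j<r → ≁ (subst (λ A → A) (sym (QK≡ centre j))
          (c≢j , inj₂ (inj₁ (Fin.toℕ-fromℕ n , j<r)))))
        (λ (c≢j , r≤j) → c≢j , λ ∼ → spoke⇒⊥ c≢j r≤j (proj₂ (subst (λ A → A) (QK≡ centre j) ∼)))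
        where
        spoke⇒⊥ : centre ≢ j → n ∸ m ≤ toℕ j →
          ¬ (toℕ centre < n × toℕ j < n ⊎ toℕ centre ≡ n × toℕ j < n ∸ m ⊎ toℕ j ≡ n × toℕ centre < n ∸ m)
        spoke⇒⊥ c≢j r≤j (inj₁ (c<n , _))        = <-irrefl (Fin.toℕ-fromℕ n) c<n
        spoke⇒⊥ c≢j r≤j (inj₂ (inj₁ (_ , j<r))) = <⇒≱ j<r r≤j
        spoke⇒⊥ c≢j r≤j (inj₂ (inj₂ (j≡n , _))) = <⇒≢ (toℕ<n (c≢j ∘ sym)) j≡n

    -- Together with its neighbours the centre fills the top indices n - m, ..., n, an interval of m
    -- + 1 vertices; hence the added 1.
    degree-QS-centre : degree (QS (suc n) m) centre ≡ m
    degree-QS-centre = suc-injective (begin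
      suc (degree (QS (suc n) m) centre)
        ≡⟨ cong₂ _+_ (sum-𝟙-≡ centre (λ _ → 1)) (sym (degree≡sum (QS (suc n) m) centre)) ⟨
      sum (λ j → 𝟙 (j Fin.≟ centre) * 1) + sum (adj (QS (suc n) m) centre)
        ≡⟨ ∑-distrib-+ (λ j → 𝟙 (j Fin.≟ centre) * 1) (adj (QS (suc n) m) centre) ⟨
      sum (λ j → 𝟙 (j Fin.≟ centre) * 1 + adj (QS (suc n) m) centre j)
        ≡⟨ sum-cong-≗ pointwise ⟩
      sum (λ (j : Fin (suc n)) → 𝟙 ((n ∸ m) ≤? toℕ j))
        ≡⟨ sum-upper (suc n) (n ∸ m) ⟩
      suc n ∸ (n ∸ m)
        ≡⟨ +-∸-assoc 1 (m∸n≤m n m) ⟩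
      suc (n ∸ (n ∸ m))
        ≡⟨ cong suc (m∸[m∸n]≡n m≤n) ⟩
      suc m ∎)
      where
      open ≡-Reasoning
      r≤c : n ∸ m ≤ toℕ centre
      r≤c = ≤-trans (m∸n≤m n m) (≤-reflexive (sym (Fin.toℕ-fromℕ n)))
      pointwise : ∀ j → 𝟙 (j Fin.≟ centre) * 1 + adj (QS (suc n) m) centre j ≡ 𝟙 ((n ∸ m) ≤? toℕ j)
      pointwise j with j Fin.≟ centre
      ... | yes refl = trans (cong suc (adj-diag (QS (suc n) m) centre))
                             (sym (𝟙-true ((n ∸ m) ≤? toℕ centre) r≤c))
      ... | no j≢c   = 𝟙-⇔ (adj? (QS (suc n) m) centre j) ((n ∸ m) ≤? toℕ j)
        (mk⇔ (proj₂ ∘ Equivalence.to (proj₂ QS-star j))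
             (λ r≤j → Equivalence.from (proj₂ QS-star j) (j≢c ∘ sym , r≤j)))

    QS∈𝔾 : 𝔾 (suc n) m (QS (suc n) m)
    QS∈𝔾 = trans (sym (isStar⇒degree≡∣E∣ (QS (suc n) m) (proj₁ QS-star))) degree-QS-centre

    degree≡m⇒≅QS : ∀ (H : Graph (suc n)) {v} → 𝔾 (suc n) m H → degree H v ≡ m → H ≅ QS (suc n) m
    degree≡m⇒≅QS H H∈𝔾 dv≡m = stars-≅ H (QS (suc n) m)
      (degree≡∣E∣⇒isStar H (trans dv≡m (sym H∈𝔾))) (proj₁ QS-star) (trans dv≡m (sym degree-QS-centre))

  -- The triangle with isolated vertices.

  module _ (s : ℕ) where

    private
      triangle : Graph (3 + s)
      triangle = K 3 ⊕ complement (K s)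

    degree-triangle : degree triangle 0F ≡ 2 × degree triangle 1F ≡ 2 × degree triangle 2F ≡ 2
    degree-triangle =
      trans (degree≡sum triangle 0F) (cong (2 +_) (sum-replicate-zero s)) ,
      trans (degree≡sum triangle 1F) (cong (2 +_) (sum-replicate-zero s)) ,
      trans (degree≡sum triangle 2F) (cong (2 +_) (sum-replicate-zero s))

    degree-isolated : ∀ i → degree triangle (suc (suc (suc i))) ≡ 0
    degree-isolated i = trans (degree≡sum triangle (suc (suc (suc i))))
      (≗0⇒sum≡0 λ j → 𝟙-false (adj? (complement (K s)) i j) λ (i≢j , ¬i≢j) → ¬i≢j i≢j)

    -- The degree sum 6 is twice the edge count, so `edges` need not be enumerated.
    triangle∈𝔾 : 𝔾 (3 + s) 3 triangle
    triangle∈𝔾 = ≤-antisym (m+m≤n+n⇒m≤n (≤-reflexive (trans (sym (handshake triangle)) total)))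
                           (m+m≤n+n⇒m≤n (≤-reflexive (trans (sym total) (handshake triangle))))
      where
      total : sum (degree triangle) ≡ 6
      total with d0 , d1 , d2 ← degree-triangle =
        cong₂ _+_ d0 (cong₂ _+_ d1 (cong₂ _+_ d2 (≗0⇒sum≡0 degree-isolated)))

open import Defs
open import Algebra.Bundles using (AbelianGroup)
import Algebra.Definitions.RawMonoid as RawMonoid
import Algebra.Properties.CommutativeMonoid.Mult as Mult
import Algebra.Properties.CommutativeMonoid.Sum as Sum
open import Data.Fin as Fin using (Fin; zero; suc)
open import Data.Fin.Patterns using (0F)
import Data.Fin.Properties as Fin
open import Data.Nat using (ℕ; zero; suc; _∸_; z≤n; s≤s)
import Data.Nat as ℕ
import Data.Nat.Properties as ℕ
open import Data.Product using (_×_; _,_; proj₁)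
open import Data.Rational as ℚ using (ℚ; 0ℚ; ½; ∣_∣)
import Data.Rational.Properties as ℚ
open import Data.Rational.Solver using (module +-*-Solver)
open import Data.Sum using (_⊎_; inj₁; inj₂; [_,_]′)
open import Function using (_∘_)
open import Level using (0ℓ)
open import Relation.Binary.Bundles using (Preorder)
open import Relation.Binary.PropositionalEquality
  using (_≡_; _≢_; refl; sym; trans; cong; cong₂; subst; subst₂)
import Relation.Binary.Reasoning.Preorder as PreorderReasoning
open import Relation.Nullary using (¬_; yes; no; contradiction)

open Combinatorics
open Sum ℕ.+-0-commutativeMonoid using () renaming (sum to sumℕ)
open RawMonoid ℚ.+-0-rawMonoid using () renaming (_×_ to _×ℚ_)
open +-*-Solver using (solve; _:=_; _:+_; _:-_; :-_)

-- Ordered group structure of the real numbers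

½-pos : ∀ {ε} → 0ℚ ℚ.< ε → 0ℚ ℚ.< ½ ℚ.* ε
½-pos {ε} 0<ε = subst (ℚ._< ½ ℚ.* ε) (ℚ.*-zeroʳ ½) (ℚ.*-monoʳ-<-pos ½ 0<ε)

½+½ : ∀ ε → ½ ℚ.* ε ℚ.+ ½ ℚ.* ε ≡ ε
½+½ ε = trans (sym (ℚ.*-distribʳ-+ ε ½ ½)) (ℚ.*-identityˡ ε)

½-< : ∀ {ε} → 0ℚ ℚ.< ε → ½ ℚ.* ε ℚ.< ε
½-< {ε} 0<ε = subst₂ ℚ._<_ (ℚ.+-identityʳ (½ ℚ.* ε)) (½+½ ε) (ℚ.+-monoʳ-< (½ ℚ.* ε) (½-pos 0<ε))

p≤∣p∣ : ∀ p → p ℚ.≤ ∣ p ∣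
p≤∣p∣ p with ℚ.≤-total 0ℚ p
... | inj₁ 0≤p = ℚ.≤-reflexive (sym (ℚ.0≤p⇒∣p∣≡p 0≤p))
... | inj₂ p≤0 = ℚ.≤-trans p≤0 (ℚ.0≤∣p∣ p)

≤+⇒-≤ : ∀ {p q r} → p ℚ.≤ q ℚ.+ r → p ℚ.- q ℚ.≤ r
≤+⇒-≤ {p} {q} {r} p≤q+r =
  subst (p ℚ.- q ℚ.≤_) (solve 2 (λ q r → q :+ r :- q := r) refl q r) (ℚ.+-monoˡ-≤ (ℚ.- q) p≤q+r)

-≤⇒≤+ : ∀ {p q r} → p ℚ.- q ℚ.≤ r → p ℚ.≤ q ℚ.+ r
-≤⇒≤+ {p} {q} {r} p-q≤r =
  subst (ℚ._≤ q ℚ.+ r) (solve 2 (λ p q → q :+ (p :- q) := p) refl p q) (ℚ.+-monoʳ-≤ q p-q≤r)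

∣p-q∣≡∣q-p∣ : ∀ p q → ∣ p ℚ.- q ∣ ≡ ∣ q ℚ.- p ∣
∣p-q∣≡∣q-p∣ p q = trans (sym (ℚ.∣-p∣≡∣p∣ (p ℚ.- q)))
  (cong ∣_∣ (solve 2 (λ p q → :- (p :- q) := q :- p) refl p q))

∣p-q∣≤ : ∀ {p q r} → p ℚ.≤ q ℚ.+ r → q ℚ.≤ p ℚ.+ r → ∣ p ℚ.- q ∣ ℚ.≤ r
∣p-q∣≤ {p} {q} p≤q+r q≤p+r with ℚ.∣p∣≡p∨∣p∣≡-p (p ℚ.- q)
... | inj₁ eq = subst (ℚ._≤ _) (sym eq) (≤+⇒-≤ p≤q+r)
... | inj₂ eq = subst (ℚ._≤ _)
  (sym (trans eq (solve 2 (λ p q → :- (p :- q) := q :- p) refl p q))) (≤+⇒-≤ q≤p+r)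

×ℚ-distrib-+ : ∀ k p q → k ×ℚ (p ℚ.+ q) ≡ k ×ℚ p ℚ.+ k ×ℚ q
×ℚ-distrib-+ zero p q = refl
×ℚ-distrib-+ (suc k) p q = trans (cong (p ℚ.+ q ℚ.+_) (×ℚ-distrib-+ k p q))
  (solve 4 (λ p q r s → p :+ q :+ (r :+ s) := p :+ r :+ (q :+ s)) refl p q (k ×ℚ p) (k ×ℚ q))

×ℚ-mono-≤ : ∀ k {p q} → p ℚ.≤ q → k ×ℚ p ℚ.≤ k ×ℚ q
×ℚ-mono-≤ zero p≤q = ℚ.≤-refl
×ℚ-mono-≤ (suc k) p≤q = ℚ.+-mono-≤ p≤q (×ℚ-mono-≤ k p≤q)

×ℚ-mono-< : ∀ k {p q} → p ℚ.< q → suc k ×ℚ p ℚ.< suc k ×ℚ q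
×ℚ-mono-< k p<q = ℚ.+-mono-<-≤ p<q (×ℚ-mono-≤ k (ℚ.<⇒≤ p<q))

×ℚ-cancel-≤ : ∀ k {p q} → suc k ×ℚ p ℚ.≤ suc k ×ℚ q → p ℚ.≤ q
×ℚ-cancel-≤ k kp≤kq = ℚ.≮⇒≥ λ q<p → ℚ.<-irrefl refl (ℚ.<-≤-trans (×ℚ-mono-< k q<p) kp≤kq)

×ℚ-pos : ∀ k {p} → 0ℚ ℚ.< p → 0ℚ ℚ.< suc k ×ℚ p
×ℚ-pos k {p} 0<p = subst (ℚ._< suc k ×ℚ p) (×ℚ-zeroʳ (suc k)) (×ℚ-mono-< k 0<p)
  where
  ×ℚ-zeroʳ : ∀ j → j ×ℚ 0ℚ ≡ 0ℚ
  ×ℚ-zeroʳ zero = refl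
  ×ℚ-zeroʳ (suc j) = trans (ℚ.+-identityˡ _) (×ℚ-zeroʳ j)

-- Order and addition of reals, the only place where the sequences are unfolded.

opaque
  unfolding _≈_ _≤_ _<_ _+_ -_ 0ℝ

  ≈⇒≤ : ∀ {x y} → x ≈ y → x ≤ y
  ≈⇒≤ {x} {y} x≈y ε 0<ε with x≈y ε 0<ε
  ... | N , p = N , λ i N≤i → -≤⇒≤+ (ℚ.≤-trans (p≤∣p∣ (seq x i ℚ.- seq y i)) (ℚ.<⇒≤ (p i N≤i)))

  ≈-sym : ∀ {x y} → x ≈ y → y ≈ x
  ≈-sym {x} {y} x≈y ε 0<ε with x≈y ε 0<ε
  ... | N , p = N , λ i N≤i → subst (ℚ._< ε) (∣p-q∣≡∣q-p∣ (seq x i) (seq y i)) (p i N≤i)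

  -- Halving the tolerance turns the weak bounds given by `_≤_` into the strict one that `_≈_`
  -- demands.
  ≤-antisym : ∀ {x y} → x ≤ y → y ≤ x → x ≈ y
  ≤-antisym {x} {y} x≤y y≤x ε 0<ε
    with x≤y (½ ℚ.* ε) (½-pos 0<ε) | y≤x (½ ℚ.* ε) (½-pos 0<ε)
  ... | M , p | N , q = M ℕ.⊔ N , λ i M⊔N≤i → ℚ.≤-<-trans
    (∣p-q∣≤ (p i (ℕ.m⊔n≤o⇒m≤o M N M⊔N≤i)) (q i (ℕ.m⊔n≤o⇒n≤o M N M⊔N≤i)))
    (½-< 0<ε)

  ≤-trans : ∀ {x y z} → x ≤ y → y ≤ z → x ≤ z
  ≤-trans {x} {y} {z} x≤y y≤z ε 0<ε
    with x≤y (½ ℚ.* ε) (½-pos 0<ε) | y≤z (½ ℚ.* ε) (½-pos 0<ε)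
  ... | M , p | N , q = M ℕ.⊔ N , λ i M⊔N≤i → ℚ.≤-trans
    (p i (ℕ.m⊔n≤o⇒m≤o M N M⊔N≤i))
    (subst (seq y i ℚ.+ ½ ℚ.* ε ℚ.≤_)
      (trans (ℚ.+-assoc (seq z i) (½ ℚ.* ε) (½ ℚ.* ε)) (cong (seq z i ℚ.+_) (½+½ ε)))
      (ℚ.+-monoˡ-≤ (½ ℚ.* ε) (q i (ℕ.m⊔n≤o⇒n≤o M N M⊔N≤i))))

  +-mono-≤ : ∀ {x y u v} → x ≤ y → u ≤ v → x + u ≤ y + v
  +-mono-≤ {x} {y} {u} {v} x≤y u≤v ε 0<ε
    with x≤y (½ ℚ.* ε) (½-pos 0<ε) | u≤v (½ ℚ.* ε) (½-pos 0<ε)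
  ... | M , p | N , q = M ℕ.⊔ N , λ i M⊔N≤i → subst (seq x i ℚ.+ seq u i ℚ.≤_)
    (trans
      (solve 3 (λ a b e → (a :+ e) :+ (b :+ e) := a :+ b :+ (e :+ e)) refl
        (seq y i) (seq v i) (½ ℚ.* ε))
      (cong (seq y i ℚ.+ seq v i ℚ.+_) (½+½ ε)))
    (ℚ.+-mono-≤ (p i (ℕ.m⊔n≤o⇒m≤o M N M⊔N≤i)) (q i (ℕ.m⊔n≤o⇒n≤o M N M⊔N≤i)))

  -‿anti-≤ : ∀ {x y} → x ≤ y → - y ≤ - x
  -‿anti-≤ {x} {y} x≤y ε 0<ε with x≤y ε 0<ε
  ... | N , p = N , λ i N≤i → subst₂ ℚ._≤_
    (solve 2 (λ x y → x :+ (:- x :- y) := :- y) refl (seq x i) (seq y i))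
    (solve 3 (λ x y e → y :+ e :+ (:- x :- y) := :- x :+ e) refl (seq x i) (seq y i) ε)
    (ℚ.+-monoˡ-≤ (ℚ.- seq x i ℚ.- seq y i) (p i N≤i))

  <⇒≤ : ∀ {x y} → x < y → x ≤ y
  <⇒≤ {x} {y} (δ , 0<δ , N , p) ε 0<ε = N , λ i N≤i → begin
    seq x i         ≡⟨ ℚ.+-identityʳ (seq x i) ⟨
    seq x i ℚ.+ 0ℚ  ≤⟨ ℚ.+-monoʳ-≤ (seq x i) (ℚ.<⇒≤ 0<δ) ⟩
    seq x i ℚ.+ δ   ≤⟨ p i N≤i ⟩
    seq y i         ≡⟨ ℚ.+-identityʳ (seq y i) ⟨
    seq y i ℚ.+ 0ℚ  ≤⟨ ℚ.+-monoʳ-≤ (seq y i) (ℚ.<⇒≤ 0<ε) ⟩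
    seq y i ℚ.+ ε   ∎
    where open ℚ.≤-Reasoning

  <⇒≱ : ∀ {x y} → x < y → ¬ y ≤ x
  <⇒≱ {x} {y} (δ , 0<δ , M , p) y≤x with y≤x (½ ℚ.* δ) (½-pos 0<δ)
  ... | N , q = ℚ.<-irrefl refl (ℚ.<-≤-trans
    (ℚ.+-monoʳ-< (seq x i) (½-< 0<δ))
    (ℚ.≤-trans (p i (ℕ.m≤m⊔n M N)) (q i (ℕ.m≤n⊔m M N))))
    where
    i : ℕ
    i = M ℕ.⊔ N

  seq-· : ∀ k x i → seq (k · x) i ≡ k ×ℚ seq x i
  seq-· zero    x i = refl
  seq-· (suc k) x i = cong (seq x i ℚ.+_) (seq-· k x i)

  -- The hypothesis is used with tolerance (k + 1)ε, after which the factor cancels termwise in ℚ.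
  -- This stands in for division.
  ·-cancel-≤ : ∀ k {x y} → suc k · x ≤ suc k · y → x ≤ y
  ·-cancel-≤ k {x} {y} kx≤ky ε 0<ε with kx≤ky (suc k ×ℚ ε) (×ℚ-pos k 0<ε)
  ... | N , p = N , λ i N≤i → ×ℚ-cancel-≤ k (subst₂ ℚ._≤_
    (seq-· (suc k) x i)
    (trans (cong (ℚ._+ suc k ×ℚ ε) (seq-· (suc k) y i)) (sym (×ℚ-distrib-+ (suc k) (seq y i) ε)))
    (p i N≤i))

  ≗⇒≈ : ∀ x y → (∀ i → seq x i ≡ seq y i) → x ≈ y
  ≗⇒≈ x y eq ε 0<ε = 0 , λ i _ → subst (ℚ._< ε)
    (sym (cong ∣_∣ (trans (cong (ℚ._- seq y i) (eq i)) (ℚ.+-inverseʳ (seq y i))))) 0<ε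

  +-assoc : ∀ x y z → (x + y) + z ≈ x + (y + z)
  +-assoc x y z = ≗⇒≈ (x + y + z) (x + (y + z)) λ i → ℚ.+-assoc (seq x i) (seq y i) (seq z i)

  +-comm : ∀ x y → x + y ≈ y + x
  +-comm x y = ≗⇒≈ (x + y) (y + x) λ i → ℚ.+-comm (seq x i) (seq y i)

  +-identityˡ : ∀ x → 0ℝ + x ≈ x
  +-identityˡ x = ≗⇒≈ (0ℝ + x) x λ i → ℚ.+-identityˡ (seq x i)

  -‿inverseˡ : ∀ x → - x + x ≈ 0ℝ
  -‿inverseˡ x = ≗⇒≈ (- x + x) 0ℝ λ i → ℚ.+-inverseˡ (seq x i)

≈-refl : ∀ {x} → x ≈ x
≈-refl {x} = ≗⇒≈ x x λ _ → refl

-- Two inequalities and antisymmetry replace an ε-argument, here and in the congruence laws that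
-- follow.
≈-trans : ∀ {x y z} → x ≈ y → y ≈ z → x ≈ z
≈-trans x≈y y≈z = ≤-antisym
  (≤-trans (≈⇒≤ x≈y) (≈⇒≤ y≈z)) (≤-trans (≈⇒≤ (≈-sym y≈z)) (≈⇒≤ (≈-sym x≈y)))

+-cong : ∀ {x y u v} → x ≈ y → u ≈ v → x + u ≈ y + v
+-cong x≈y u≈v = ≤-antisym
  (+-mono-≤ (≈⇒≤ x≈y) (≈⇒≤ u≈v)) (+-mono-≤ (≈⇒≤ (≈-sym x≈y)) (≈⇒≤ (≈-sym u≈v)))

-‿cong : ∀ {x y} → x ≈ y → - x ≈ - y
-‿cong x≈y = ≤-antisym (-‿anti-≤ (≈⇒≤ (≈-sym x≈y))) (-‿anti-≤ (≈⇒≤ x≈y))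

+-identityʳ : ∀ x → x + 0ℝ ≈ x
+-identityʳ x = ≈-trans (+-comm x 0ℝ) (+-identityˡ x)

-‿inverseʳ : ∀ x → x - x ≈ 0ℝ
-‿inverseʳ x = ≈-trans (+-comm x (- x)) (-‿inverseˡ x)

+-0-abelianGroup : AbelianGroup 0ℓ 0ℓ
+-0-abelianGroup = record
  { Carrier = ℝ ; _≈_ = _≈_ ; _∙_ = _+_ ; ε = 0ℝ ; _⁻¹ = -_
  ; isAbelianGroup = record
    { isGroup = record
      { isMonoid = record
        { isSemigroup = record
          { isMagma = record
            { isEquivalence = record { refl = ≈-refl ; sym = ≈-sym ; trans = ≈-trans }
            ; ∙-cong = +-cong
            }
          ; assoc = +-assoc
          }
        ; identity = +-identityˡ , +-identityʳ
        }
      ; inverse = -‿inverseˡ , -‿inverseʳ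
      ; ⁻¹-cong = -‿cong
      }
    ; comm = +-comm
    }
  }

open AbelianGroup +-0-abelianGroup using (commutativeMonoid)
open Sum commutativeMonoid using (sum-cong-≋; ∑-distrib-+; sum-replicate-zero)
open Mult commutativeMonoid using () renaming
  ( ×-congʳ to ·-congʳ; ×-congˡ to ·-congˡ; ×-homo-+ to ·-homo-+
  ; ×-assocˡ to ·-assocˡ; ×-distrib-+ to ·-distrib-+ )

≤-preorder : Preorder 0ℓ 0ℓ 0ℓ
≤-preorder = record
  { Carrier = ℝ ; _≈_ = _≈_ ; _≲_ = _≤_
  ; isPreorder = record
    { isEquivalence = AbelianGroup.isEquivalence +-0-abelianGroup
    ; reflexive = ≈⇒≤
    ; trans = ≤-trans
    }
  }

open PreorderReasoning ≤-preorder

≤-refl : ∀ {x} → x ≤ x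
≤-refl = ≈⇒≤ ≈-refl

-- Cancellation, natural multiples and finite sums of reals.

x+y-y≈x : ∀ x y → x + y - y ≈ x
x+y-y≈x x y = begin-equality
  x + y - y      ≈⟨ +-assoc x y (- y) ⟩
  x + (y - y)    ≈⟨ +-cong ≈-refl (-‿inverseʳ y) ⟩
  x + 0ℝ         ≈⟨ +-identityʳ x ⟩
  x              ∎

x-y+y≈x : ∀ x y → x - y + y ≈ x
x-y+y≈x x y = begin-equality
  x - y + y      ≈⟨ +-assoc x (- y) y ⟩
  x + (- y + y)  ≈⟨ +-cong ≈-refl (-‿inverseˡ y) ⟩
  x + 0ℝ         ≈⟨ +-identityʳ x ⟩
  x              ∎

+-cancelʳ-≤ : ∀ {x y} z → x + z ≤ y + z → x ≤ y
+-cancelʳ-≤ {x} {y} z x+z≤y+z = begin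
  x          ≈⟨ x+y-y≈x x z ⟨
  x + z - z  ≲⟨ +-mono-≤ x+z≤y+z ≤-refl ⟩
  y + z - z  ≈⟨ x+y-y≈x y z ⟩
  y          ∎

·-zeroʳ : ∀ k → k · 0ℝ ≈ 0ℝ
·-zeroʳ zero    = ≈-refl
·-zeroʳ (suc k) = ≈-trans (+-identityˡ (k · 0ℝ)) (·-zeroʳ k)

·-swap : ∀ j k x → j · k · x ≈ k · j · x
·-swap j k x = begin-equality
  j · k · x      ≈⟨ ·-assocˡ x j k ⟩
  (j ℕ.* k) · x  ≈⟨ ·-congˡ (ℕ.*-comm j k) ⟩
  (k ℕ.* j) · x  ≈⟨ ·-assocˡ x k j ⟨
  k · j · x      ∎

·-monoʳ-≤ : ∀ k {x y} → x ≤ y → k · x ≤ k · y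
·-monoʳ-≤ zero    x≤y = ≤-refl
·-monoʳ-≤ (suc k) x≤y = +-mono-≤ x≤y (·-monoʳ-≤ k x≤y)

·-nonneg : ∀ k {x} → 0ℝ ≤ x → 0ℝ ≤ k · x
·-nonneg k {x} 0≤x = begin
  0ℝ      ≈⟨ ·-zeroʳ k ⟨
  k · 0ℝ  ≲⟨ ·-monoʳ-≤ k 0≤x ⟩
  k · x   ∎

·-monoˡ-≤ : ∀ {j k x} → 0ℝ ≤ x → j ℕ.≤ k → j · x ≤ k · x
·-monoˡ-≤ {k = k} 0≤x z≤n  = ·-nonneg k 0≤x
·-monoˡ-≤ 0≤x (s≤s j≤k) = +-mono-≤ ≤-refl (·-monoˡ-≤ 0≤x j≤k)

·-nonpos⁻¹ : ∀ k {x} → suc k · x ≤ 0ℝ → x ≤ 0ℝ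
·-nonpos⁻¹ k kx≤0 = ·-cancel-≤ k (≤-trans kx≤0 (≈⇒≤ (≈-sym (·-zeroʳ (suc k)))))

-- Cancelling `j · x` leaves a positive multiple of `x` below zero. In this form a strict inequality
-- between coefficients contradicts positivity of `x`.
·-anti⇒≤0 : ∀ {j k x} → j ℕ.< k → k · x ≤ j · x → x ≤ 0ℝ
·-anti⇒≤0 {j} {k} {x} j<k kx≤jx with t , refl ← ℕ.m≤n⇒∃[o]m+o≡n j<k =
  ·-nonpos⁻¹ t (+-cancelʳ-≤ (j · x) (begin
    suc t · x + j · x      ≈⟨ ·-homo-+ x (suc t) j ⟨
    (suc t ℕ.+ j) · x      ≈⟨ ·-congˡ (cong suc (ℕ.+-comm t j)) ⟩
    (suc j ℕ.+ t) · x      ≲⟨ kx≤jx ⟩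
    j · x                  ≈⟨ +-identityˡ (j · x) ⟨
    0ℝ + j · x             ∎))

∑-mono-≤ : ∀ {n} {s t : Fin n → ℝ} → (∀ i → s i ≤ t i) → sum s ≤ sum t
∑-mono-≤ {zero}  s≤t = ≤-refl
∑-mono-≤ {suc n} s≤t = +-mono-≤ (s≤t zero) (∑-mono-≤ (s≤t ∘ suc))

∑-nonneg : ∀ {n} {t : Fin n → ℝ} → (∀ i → 0ℝ ≤ t i) → 0ℝ ≤ sum t
∑-nonneg {n} {t} 0≤t = begin
  0ℝ                     ≈⟨ sum-replicate-zero n ⟨
  sum {n} (λ _ → 0ℝ)     ≲⟨ ∑-mono-≤ 0≤t ⟩
  sum t                  ∎

term≤∑ : ∀ {n} {t : Fin n → ℝ} → (∀ i → 0ℝ ≤ t i) → ∀ i → t i ≤ sum t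
term≤∑ {t = t} 0≤t zero = begin
  t zero              ≈⟨ +-identityʳ (t zero) ⟨
  t zero + 0ℝ         ≲⟨ +-mono-≤ ≤-refl (∑-nonneg (0≤t ∘ suc)) ⟩
  sum t               ∎
term≤∑ {t = t} 0≤t (suc i) = begin
  t (suc i)               ≈⟨ +-identityˡ (t (suc i)) ⟨
  0ℝ + t (suc i)          ≲⟨ +-mono-≤ (0≤t zero) (term≤∑ (0≤t ∘ suc) i) ⟩
  sum t                   ∎

·-distribˡ-∑ : ∀ {n} k (t : Fin n → ℝ) → k · sum t ≈ sum (λ i → k · t i)
·-distribˡ-∑ {zero}  k t = ·-zeroʳ k
·-distribˡ-∑ {suc n} k t =
  ≈-trans (·-distrib-+ (t zero) (sum (t ∘ suc)) k) (+-cong ≈-refl (·-distribˡ-∑ k (t ∘ suc)))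

·-distribʳ-∑ : ∀ {n} (d : Fin n → ℕ) x → sum (λ i → d i · x) ≈ sumℕ d · x
·-distribʳ-∑ {zero}  d x = ≈-refl
·-distribʳ-∑ {suc n} d x =
  ≈-trans (+-cong ≈-refl (·-distribʳ-∑ (d ∘ suc) x)) (≈-sym (·-homo-+ x (d zero) (sumℕ (d ∘ suc))))

-- Maximizing Σ f over 𝔾 n m

module _ {f : ℕ → ℝ} (f∈𝓕 : 𝓕 f) where

  open 𝓕 f∈𝓕

  g : ℕ → ℝ
  g k = f k - k · f 1

  f≈g+k·f1 : ∀ k → f k ≈ g k + k · f 1
  f≈g+k·f1 k = ≈-sym (x-y+y≈x (f k) (k · f 1))

  g0≈0 : g 0 ≈ 0ℝ
  g0≈0 = ≈-trans (+-cong f0≈0 ≈-refl) (-‿inverseʳ 0ℝ)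

  g1≈0 : g 1 ≈ 0ℝ
  g1≈0 = ≈-trans (+-cong ≈-refl (-‿cong (+-identityʳ (f 1)))) (-‿inverseʳ (f 1))

  f-f1≈g+k·f1 : ∀ k → f (suc k) - f 1 ≈ g (suc k) + k · f 1
  f-f1≈g+k·f1 k = begin-equality
    f (suc k) - f 1                          ≈⟨ +-cong (f≈g+k·f1 (suc k)) ≈-refl ⟩
    g (suc k) + (f 1 + k · f 1) - f 1        ≈⟨ +-cong (+-cong ≈-refl (+-comm (f 1) (k · f 1))) ≈-refl ⟩
    g (suc k) + (k · f 1 + f 1) - f 1        ≈⟨ +-cong (+-assoc (g (suc k)) (k · f 1) (f 1)) ≈-refl ⟨
    g (suc k) + k · f 1 + f 1 - f 1          ≈⟨ x+y-y≈x (g (suc k) + k · f 1) (f 1) ⟩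
    g (suc k) + k · f 1                      ∎

  -- With k = 3 + j, the linear part of f contributes k(k - 2) f(1) to both sides of the growth
  -- condition and cancels.
  g-growth : ∀ j → (3 ℕ.+ j) · g (2 ℕ.+ j) ≤ (1 ℕ.+ j) · g (3 ℕ.+ j)
  g-growth j = +-cancelʳ-≤ ((3 ℕ.+ j) · (1 ℕ.+ j) · f 1) (begin
    (3 ℕ.+ j) · g (2 ℕ.+ j) + (3 ℕ.+ j) · (1 ℕ.+ j) · f 1
      ≈⟨ ·-distrib-+ (g (2 ℕ.+ j)) ((1 ℕ.+ j) · f 1) (3 ℕ.+ j) ⟨
    (3 ℕ.+ j) · (g (2 ℕ.+ j) + (1 ℕ.+ j) · f 1)
      ≈⟨ ·-congʳ (3 ℕ.+ j) (f-f1≈g+k·f1 (1 ℕ.+ j)) ⟨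
    (3 ℕ.+ j) · (f (2 ℕ.+ j) - f 1)
      ≲⟨ growth (3 ℕ.+ j) (s≤s (s≤s (s≤s z≤n))) ⟩
    (1 ℕ.+ j) · f (3 ℕ.+ j)
      ≈⟨ ·-congʳ (1 ℕ.+ j) (f≈g+k·f1 (3 ℕ.+ j)) ⟩
    (1 ℕ.+ j) · (g (3 ℕ.+ j) + (3 ℕ.+ j) · f 1)
      ≈⟨ ·-distrib-+ (g (3 ℕ.+ j)) ((3 ℕ.+ j) · f 1) (1 ℕ.+ j) ⟩
    (1 ℕ.+ j) · g (3 ℕ.+ j) + (1 ℕ.+ j) · (3 ℕ.+ j) · f 1
      ≈⟨ +-cong ≈-refl (·-swap (1 ℕ.+ j) (3 ℕ.+ j) (f 1)) ⟩
    (1 ℕ.+ j) · g (3 ℕ.+ j) + (3 ℕ.+ j) · (1 ℕ.+ j) · f 1 ∎)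

  f1≈f1-f0 : f 1 ≈ f 1 - f 0
  f1≈f1-f0 = ≈-sym (≈-trans (+-cong ≈-refl (-‿cong f0≈0)) (x-0≈x (f 1)))
    where
    x-0≈x : ∀ x → x - 0ℝ ≈ x
    x-0≈x x = ≈-trans (+-cong (≈-sym (+-identityʳ x)) ≈-refl) (x+y-y≈x x 0ℝ)

  f2-f1≈g2+f1 : f 2 - f 1 ≈ g 2 + f 1
  f2-f1≈g2+f1 = ≈-trans (f-f1≈g+k·f1 1) (+-cong ≈-refl (+-identityʳ (f 1)))

  -- As f(0) = 0, `g 2` is the second difference of f at 0.
  g2≥0 : 0ℝ ≤ g 2
  g2≥0 = +-cancelʳ-≤ (f 1) (begin
    0ℝ + f 1   ≈⟨ +-identityˡ (f 1) ⟩
    f 1        ≈⟨ f1≈f1-f0 ⟩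
    f 1 - f 0  ≲⟨ <⇒≤ (convex 0) ⟩
    f 2 - f 1  ≈⟨ f2-f1≈g2+f1 ⟩
    g 2 + f 1  ∎)

  -- Positivity is put negatively because it serves only to refute.
  g2≰0 : ¬ g 2 ≤ 0ℝ
  g2≰0 g2≤0 = <⇒≱ (convex 0) (begin
    f 2 - f 1  ≈⟨ f2-f1≈g2+f1 ⟩
    g 2 + f 1  ≲⟨ +-mono-≤ g2≤0 ≤-refl ⟩
    0ℝ + f 1   ≈⟨ +-identityˡ (f 1) ⟩
    f 1        ≈⟨ f1≈f1-f0 ⟩
    f 1 - f 0  ∎)

  -- That is, g k / (k (k - 1)) is nondecreasing in k.
  g-ratio : ∀ {k D} → 2 ℕ.≤ k → k ℕ.≤′ D → (D ℕ.* (D ∸ 1)) · g k ≤ (k ℕ.* (k ∸ 1)) · g D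
  g-ratio 2≤k ℕ.≤′-refl = ≤-refl
  g-ratio {k} {suc D} 2≤k (ℕ.≤′-step k≤D) with s≤s (s≤s (z≤n {j})) ← ℕ.≤-trans 2≤k (ℕ.≤′⇒≤ k≤D) =
    -- With D = 2 + j, the factor 1 + j turns (3 + j)(2 + j) into 3 + j times the coefficient D(D -
    -- 1) of the induction hypothesis. `g-growth` leaves the same factor on the right, so it
    -- cancels.
    ·-cancel-≤ j (begin
      (1 ℕ.+ j) · ((3 ℕ.+ j) ℕ.* (2 ℕ.+ j)) · g k
        ≈⟨ ·-congʳ (1 ℕ.+ j) (·-assocˡ (g k) (3 ℕ.+ j) (2 ℕ.+ j)) ⟨
      (1 ℕ.+ j) · (3 ℕ.+ j) · (2 ℕ.+ j) · g k
        ≈⟨ ·-swap (1 ℕ.+ j) (3 ℕ.+ j) ((2 ℕ.+ j) · g k) ⟩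
      (3 ℕ.+ j) · (1 ℕ.+ j) · (2 ℕ.+ j) · g k
        ≈⟨ ·-congʳ (3 ℕ.+ j) (≈-trans (·-swap (1 ℕ.+ j) (2 ℕ.+ j) (g k)) (·-assocˡ (g k) (2 ℕ.+ j) (1 ℕ.+ j))) ⟩
      (3 ℕ.+ j) · ((2 ℕ.+ j) ℕ.* (1 ℕ.+ j)) · g k
        ≲⟨ ·-monoʳ-≤ (3 ℕ.+ j) (g-ratio 2≤k k≤D) ⟩
      (3 ℕ.+ j) · k[k-1] · g (2 ℕ.+ j)
        ≈⟨ ·-swap (3 ℕ.+ j) k[k-1] (g (2 ℕ.+ j)) ⟩
      k[k-1] · (3 ℕ.+ j) · g (2 ℕ.+ j)
        ≲⟨ ·-monoʳ-≤ k[k-1] (g-growth j) ⟩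
      k[k-1] · (1 ℕ.+ j) · g (3 ℕ.+ j)
        ≈⟨ ·-swap k[k-1] (1 ℕ.+ j) (g (3 ℕ.+ j)) ⟩
      (1 ℕ.+ j) · k[k-1] · g (3 ℕ.+ j) ∎)
    where k[k-1] = k ℕ.* (k ∸ 1)

  -- For k ≤ 1 both sides vanish, so degrees 0 and 1 need no separate treatment in sums.
  g-scale : ∀ {k D} → k ℕ.≤ D → (D ℕ.* (D ∸ 1)) · g k ≤ (k ℕ.* (k ∸ 1)) · g D
  g-scale {0} {D} _ = ≈⇒≤ (≈-trans (·-congʳ (D ℕ.* (D ∸ 1)) g0≈0) (·-zeroʳ (D ℕ.* (D ∸ 1))))
  g-scale {1} {D} _ = ≈⇒≤ (≈-trans (·-congʳ (D ℕ.* (D ∸ 1)) g1≈0) (·-zeroʳ (D ℕ.* (D ∸ 1))))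
  g-scale {suc (suc k)} k≤D = g-ratio (s≤s (s≤s z≤n)) (ℕ.≤⇒≤′ k≤D)

  g≥0 : ∀ k → 0ℝ ≤ g k
  g≥0 0 = ≈⇒≤ (≈-sym g0≈0)
  g≥0 1 = ≈⇒≤ (≈-sym g1≈0)
  g≥0 k@(suc (suc j)) = ·-cancel-≤ 1 (begin
    2 · 0ℝ                ≈⟨ ·-zeroʳ 2 ⟩
    0ℝ                    ≲⟨ ·-nonneg (k ℕ.* (k ∸ 1)) g2≥0 ⟩
    (k ℕ.* (k ∸ 1)) · g 2  ≲⟨ g-scale (s≤s (s≤s z≤n)) ⟩
    2 · g k               ∎)

  g≰0 : ∀ {k} → 2 ℕ.≤ k → ¬ g k ≤ 0ℝ
  -- The first argument of `·-nonpos⁻¹` is k(k - 1) - 1 for k = 2 + j, in the form to which the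
  -- product reduces.
  g≰0 {k} 2≤k@(s≤s (s≤s (z≤n {j}))) gk≤0 = g2≰0 (·-nonpos⁻¹ (j ℕ.+ suc j ℕ.* suc j) (begin
    (k ℕ.* (k ∸ 1)) · g 2  ≲⟨ g-scale 2≤k ⟩
    2 · g k               ≲⟨ ·-monoʳ-≤ 2 gk≤0 ⟩
    2 · 0ℝ                ≈⟨ ·-zeroʳ 2 ⟩
    0ℝ                    ∎))

  ∑g-scale : ∀ {n D} (d : Fin n → ℕ) → (∀ i → d i ℕ.≤ D) →
             (D ℕ.* (D ∸ 1)) · sum (g ∘ d) ≤ sumℕ (λ i → d i ℕ.* (d i ∸ 1)) · g D
  ∑g-scale {D = D} d d≤D = begin
    (D ℕ.* (D ∸ 1)) · sum (g ∘ d)                ≈⟨ ·-distribˡ-∑ (D ℕ.* (D ∸ 1)) (g ∘ d) ⟩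
    sum (λ i → (D ℕ.* (D ∸ 1)) · g (d i))        ≲⟨ ∑-mono-≤ (λ i → g-scale (d≤D i)) ⟩
    sum (λ i → (d i ℕ.* (d i ∸ 1)) · g D)        ≈⟨ ·-distribʳ-∑ (λ i → d i ℕ.* (d i ∸ 1)) (g D) ⟩
    sumℕ (λ i → d i ℕ.* (d i ∸ 1)) · g D         ∎

  -- Upper bounds for the sum of g over a degree sequence.

  module _ {n m} (H : Graph n) (H∈𝔾 : 𝔾 n m H) where

    private
      d = degree H

    sum-d : sumℕ d ≡ m ℕ.+ m
    sum-d = trans (handshake H) (cong₂ ℕ._+_ H∈𝔾 H∈𝔾)

    d≤m : ∀ i → d i ℕ.≤ m
    d≤m i = subst (d i ℕ.≤_) H∈𝔾 (degree≤∣E∣ H i)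

    d+d≤1+m : ∀ {i j} → i ≢ j → d i ℕ.+ d j ℕ.≤ suc m
    d+d≤1+m i≢j = subst (λ m → _ ℕ.≤ suc m) H∈𝔾 (degree+degree≤1+∣E∣ H i≢j)

    Σf≈Σg : Σ[ f ] d ≈ sum (g ∘ d) + (m ℕ.+ m) · f 1
    Σf≈Σg = begin-equality
      sum (f ∘ d)                                ≈⟨ sum-cong-≋ (λ i → f≈g+k·f1 (d i)) ⟩
      sum (λ i → g (d i) + d i · f 1)            ≈⟨ ∑-distrib-+ (g ∘ d) (λ i → d i · f 1) ⟩
      sum (g ∘ d) + sum (λ i → d i · f 1)        ≈⟨ +-cong ≈-refl (·-distribʳ-∑ d (f 1)) ⟩
      sum (g ∘ d) + sumℕ d · f 1                 ≈⟨ +-cong ≈-refl (·-congˡ sum-d) ⟩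
      sum (g ∘ d) + (m ℕ.+ m) · f 1              ∎

    ∑g≤g : sum (g ∘ d) ≤ g m
    ∑g≤g with 2 ℕ.≤? m
    ... | yes (s≤s (s≤s (z≤n {j}))) = ·-cancel-≤ (j ℕ.+ suc j ℕ.* suc j) (begin
      (m ℕ.* (m ∸ 1)) · sum (g ∘ d)             ≲⟨ ∑g-scale d d≤m ⟩
      sumℕ (λ i → d i ℕ.* (d i ∸ 1)) · g m
        ≲⟨ ·-monoˡ-≤ (g≥0 m) (∑d[d-1]≤m[m-1] d sum-d d≤m d+d≤1+m) ⟩
      (m ℕ.* (m ∸ 1)) · g m                     ∎)
    -- For m ≤ 1 the factor m(m - 1) is zero and cannot be cancelled, but g vanishes at every
    -- degree.
    ... | no 2≰m = begin
      sum (g ∘ d)             ≲⟨ ∑-mono-≤ (λ i → ≈⇒≤ (g≈0 (ℕ.≤-trans (d≤m i) (ℕ.≤-pred (ℕ.≰⇒> 2≰m))))) ⟩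
      sum {n} (λ _ → 0ℝ)      ≈⟨ sum-replicate-zero n ⟩
      0ℝ                      ≲⟨ g≥0 m ⟩
      g m                     ∎
      where
      g≈0 : ∀ {k} → k ℕ.≤ 1 → g k ≈ 0ℝ
      g≈0 z≤n       = g0≈0
      g≈0 (s≤s z≤n) = g1≈0

    ∑g≤3·g2 : m ≡ 3 → (∀ i → d i ≢ m) → sum (g ∘ d) ≤ 3 · g 2
    ∑g≤3·g2 refl d≢3 = ·-cancel-≤ 1 (begin
      2 · sum (g ∘ d)                           ≲⟨ ∑g-scale d (λ i → ℕ.≤-pred (ℕ.≤∧≢⇒< (d≤m i) (d≢3 i))) ⟩
      sumℕ (λ i → d i ℕ.* (d i ∸ 1)) · g 2
        ≲⟨ ·-monoˡ-≤ g2≥0 (∑d[d-1]≤m[m-1] d sum-d d≤m d+d≤1+m) ⟩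
      -- Here 6 = m(m - 1) for m = 3, against D(D - 1) = 2 on the left for D = 2.
      6 · g 2                                   ≈⟨ ·-assocˡ (g 2) 2 3 ⟨
      2 · 3 · g 2                               ∎)

  -- `g m` bounds the sum of g for every competitor, so reaching it suffices; both the quasi-star
  -- and the triangle are handled this way.
  maximizes : ∀ {n m} (G : Graph n) → 𝔾 n m G → g m ≤ sum (g ∘ degree G) → Maximizes f n m G
  maximizes {m = m} G G∈𝔾 gm≤∑g = G∈𝔾 , λ H H∈𝔾 → begin
    Σ[ f ] (degree H)                              ≈⟨ Σf≈Σg H H∈𝔾 ⟩
    sum (g ∘ degree H) + (m ℕ.+ m) · f 1           ≲⟨ +-mono-≤ (≤-trans (∑g≤g H H∈𝔾) gm≤∑g) ≤-refl ⟩
    sum (g ∘ degree G) + (m ℕ.+ m) · f 1           ≈⟨ Σf≈Σg G G∈𝔾 ⟨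
    Σ[ f ] (degree G)                              ∎

  -- Maximality and uniqueness of the quasi-star.

  module _ {n m : ℕ} (m≤n : m ℕ.≤ n) where

    -- The centre alone contributes `g m`, and no other term is negative.
    g≤∑g-QS : g m ≤ sum (g ∘ degree (QS (suc n) m))
    g≤∑g-QS = subst (λ k → g k ≤ sum (g ∘ degree (QS (suc n) m))) (degree-QS-centre m≤n)
      (term≤∑ (λ i → g≥0 (degree (QS (suc n) m) i)) (Fin.fromℕ n))

    QS-maximizes : Maximizes f (suc n) m (QS (suc n) m)
    QS-maximizes = maximizes (QS (suc n) m) (QS∈𝔾 m≤n) g≤∑g-QS

    g≤∑g : ∀ H → Maximizes f (suc n) m H → g m ≤ sum (g ∘ degree H)
    g≤∑g H (H∈𝔾 , max) = ≤-trans g≤∑g-QS (+-cancelʳ-≤ ((m ℕ.+ m) · f 1) (begin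
      sum (g ∘ degree (QS (suc n) m)) + (m ℕ.+ m) · f 1  ≈⟨ Σf≈Σg (QS (suc n) m) (QS∈𝔾 m≤n) ⟨
      Σ[ f ] (degree (QS (suc n) m))                     ≲⟨ max (QS (suc n) m) (QS∈𝔾 m≤n) ⟩
      Σ[ f ] (degree H)                                  ≈⟨ Σf≈Σg H H∈𝔾 ⟩
      sum (g ∘ degree H) + (m ℕ.+ m) · f 1               ∎))

    -- For m ≥ 2 other than 3, the strict quadratic bound would force g(m) ≤ 0. For m = 3 all
    -- degrees are at most 2, giving g(3) ≤ 3 g(2), which is f(3) ≤ 3(f(2) - f(1)) once 3 f(1) is
    -- added.
    no-centre⇒⊥ : ∀ H → m ≢ 3 ⊎ 3 · (f 2 - f 1) < f 3 → Maximizes f (suc n) m H →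
                  ¬ (∀ v → degree H v ≢ m)
    no-centre⇒⊥ H m≢3∨< max@(H∈𝔾 , _) d≢m with 2 ℕ.≤? m
    -- For m = 0 every vertex has degree m; for m = 1, degrees all different from 1 would sum to 0
    -- and not to 2.
    ... | no 2≰m = d≢m 0F (ℕ.≤-antisym (d≤m H H∈𝔾 0F) (m≤d (ℕ.≰⇒> 2≰m)))
      where
      m≤d : m ℕ.< 2 → m ℕ.≤ degree H 0F
      m≤d (s≤s z≤n)       = z≤n
      m≤d (s≤s (s≤s z≤n)) = contradiction
        (trans (sym (sum-d H H∈𝔾)) (≗0⇒sum≡0 λ v → ℕ.n<1⇒n≡0 (ℕ.≤∧≢⇒< (d≤m H H∈𝔾 v) (d≢m v))))
        λ ()
    ... | yes 2≤m with m ℕ.≟ 3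
    ...   | no m≢3 = g≰0 2≤m (·-anti⇒≤0
      (∑d[d-1]<m[m-1] (degree H) (sum-d H H∈𝔾) (d≤m H H∈𝔾) (d+d≤1+m H H∈𝔾) 2≤m m≢3 d≢m)
      (≤-trans (·-monoʳ-≤ (m ℕ.* (m ∸ 1)) (g≤∑g H max)) (∑g-scale (degree H) (d≤m H H∈𝔾))))
    ...   | yes refl = [ (λ 3≢3 → 3≢3 refl) , (λ lt → <⇒≱ lt (begin
      f 3                          ≈⟨ f≈g+k·f1 3 ⟩
      g 3 + 3 · f 1                ≲⟨ +-mono-≤ (≤-trans (g≤∑g H max) (∑g≤3·g2 H H∈𝔾 refl d≢m)) ≤-refl ⟩
      3 · g 2 + 3 · f 1            ≈⟨ ·-distrib-+ (g 2) (f 1) 3 ⟨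
      3 · (g 2 + f 1)              ≈⟨ ·-congʳ 3 f2-f1≈g2+f1 ⟨
      3 · (f 2 - f 1)              ∎)) ]′ m≢3∨<

    QS-unique : m ≢ 3 ⊎ 3 · (f 2 - f 1) < f 3 → UniquelyMaximizes f (suc n) m (QS (suc n) m)
    QS-unique m≢3∨< = QS-maximizes , unique
      where
      unique : ∀ H → Maximizes f (suc n) m H → H ≅ QS (suc n) m
      unique H max with Fin.any? (λ v → degree H v ℕ.≟ m)
      ... | yes (v , dv≡m) = degree≡m⇒≅QS m≤n H (proj₁ max) dv≡m
      ... | no none = contradiction (λ v dv≡m → none (v , dv≡m)) (no-centre⇒⊥ H m≢3∨< max)

  -- The hypothesis amounts to g(3) = 3 g(2), and the three vertices of degree 2 attain this.
  triangle-maximizes : f 3 ≈ 3 · (f 2 - f 1) → ∀ s → Maximizes f (3 ℕ.+ s) 3 (K 3 ⊕ complement (K s))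
  triangle-maximizes f3≈ s = maximizes (K 3 ⊕ complement (K s)) (triangle∈𝔾 s) (begin
    g 3                                            ≲⟨ g3≤3·g2 ⟩
    3 · g 2                                        ≲⟨ 3·g2≤∑g ⟩
    sum (g ∘ degree (K 3 ⊕ complement (K s)))      ∎)
    where
    g3≤3·g2 : g 3 ≤ 3 · g 2
    g3≤3·g2 = +-cancelʳ-≤ (3 · f 1) (begin
      g 3 + 3 · f 1       ≈⟨ f≈g+k·f1 3 ⟨
      f 3                 ≈⟨ f3≈ ⟩
      3 · (f 2 - f 1)     ≈⟨ ·-congʳ 3 f2-f1≈g2+f1 ⟩
      3 · (g 2 + f 1)     ≈⟨ ·-distrib-+ (g 2) (f 1) 3 ⟩
      3 · g 2 + 3 · f 1   ∎)
    3·g2≤∑g : 3 · g 2 ≤ sum (g ∘ degree (K 3 ⊕ complement (K s)))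
    3·g2≤∑g with d0 , d1 , d2 ← degree-triangle s =
      +-mono-≤ (g2≤g d0) (+-mono-≤ (g2≤g d1) (+-mono-≤ (g2≤g d2)
        (∑-nonneg λ i → g≥0 (degree (K 3 ⊕ complement (K s)) (suc (suc (suc i)))))))
      where
      g2≤g : ∀ {k} → k ≡ 2 → g 2 ≤ g k
      g2≤g refl = ≤-refl

theorem5 : (f : ℕ → ℝ) → 𝓕 f →
    (∀ n m → 1 ℕ.≤ n → m ℕ.≤ n ∸ 1 →
    Maximizes f n m (QS n m) ×
    (m ≢ 3 ⊎ 3 · (f 2 - f 1) < f 3 → UniquelyMaximizes f n m (QS n m)))
    ×
    (f 3 ≈ 3 · (f 2 - f 1) →
    ∀ s → 4 ℕ.≤ 3 ℕ.+ s →
    Maximizes f (3 ℕ.+ s) 3 (K 3 ⊕ complement (K s)))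
theorem5 f f∈𝓕 =
  (λ { (suc n) m _ m≤n → QS-maximizes f∈𝓕 m≤n , QS-unique f∈𝓕 m≤n }) ,
  (λ f3≈ s _ → triangle-maximizes f∈𝓕 f3≈ s)
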